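{- For every $\delta>0$ there exists $\tau>0$ such that for every $\nu>0$ there exist $n_0\in\mathbb{N}$ and a function $\eta:\mathbb{N}\to[0,\infty)$ with $\eta(n)\to 0$ as $n\to\infty$ (both depending only on $\delta,\tau,\nu$) for which the following holds. Let $n\ge n_0$ be even and let $d\ge \delta n$. Then for every $d$-regular robust $(\nu,\tau)$-expander $G$ on $n$ vertices, every edge $e\in E(G)$, and $M$ chosen uniformly at random from the set of all perfect matchings of $G$, we have $$\left|\,d\cdot\mathbb{P}[e\in M]-1\,\right|\le \eta(n),$$ that is, $\mathbb{P}[e\in M]=(1+o_n(1))d^{ -1}$.
   Context: All graphs are finite and simple. Let $\nu,\tau>0$ and let $G$ be a graph on $n$ vertices. For $S\subseteq V(G)$, the $\nu$-robust neighbourhood $RN_{\nu,G}(S)$ of $S$ in $G$ is the set of vertices of $G$ which have at least $\nu n$ neighbours in $S$. The graph $G$ is a robust $(\nu,\tau)$-expander if $|RN_{\nu,G}(S)|\ge |S|+\nu n$ for every $S\subseteq V(G)$ with $\tau n\le |S|\le (1-\tau)n$. Perfect matchings are regarded as sets of edges. -}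

module Defs where

open import Algebra.Bundles using (CommutativeRing)
open import Algebra.Core using (Op₁; Op₂)
import Algebra.Construct.NaturalChoice.Max as Max
import Algebra.Definitions.RawMonoid as RawMonoidDefs
open import Data.Bool.Base using (Bool; true; false)
import Data.Bool.Properties as Bool
open import Data.Fin.Base using (Fin)
import Data.Fin.Base as Fin
import Data.Fin.Properties as Fin
open import Data.Fin.Subset using (Subset; _∩_; ∣_∣)
open import Data.List.Base using (List; []; _∷_; _++_; map; filter; length; allFin; cartesianProduct)
open import Data.List.Membership.Propositional using (_∈_)
import Data.List.Membership.DecPropositional as DecMembership
open import Data.Nat.Base using (ℕ)
import Data.Nat.Base as ℕ
import Data.Nat.Properties as ℕ
open import Data.Product.Base using (_×_; _,_; ∃-syntax)
open import Data.Product.Properties using (≡-dec)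
open import Data.Sum.Base using (_⊎_)
open import Data.Vec.Base using (tabulate)
open import Level using (_⊔_; suc)
open import Relation.Binary.Bundles using (DecTotalOrder)
open import Relation.Binary.Core using (Rel)
open import Relation.Binary.Definitions using (DecidableEquality)
import Relation.Binary.Construct.NonStrictToStrict as ToStrict
open import Relation.Binary.PropositionalEquality.Core using (_≡_)
open import Relation.Binary.Structures using (IsDecTotalOrder)
open import Relation.Nullary.Decidable using (Dec; does; _×-dec_; _⊎-dec_)
open import Relation.Unary using (Pred; Decidable)

-- Stand-in for ℝ, which the standard library lacks. In classical mathematics ℝ
-- is an instance, as is every subfield of it; completeness is not required.
record ArchimedeanOrderedField c ℓ₁ ℓ₂ : Set (suc (c ⊔ ℓ₁ ⊔ ℓ₂)) where
  infix 8 _⁻¹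
  infix 4 _≤_
  field
    commutativeRing : CommutativeRing c ℓ₁
  open CommutativeRing commutativeRing public
  field
    _⁻¹             : Op₁ Carrier   -- the value at 0# is unconstrained
    _≤_             : Rel Carrier ℓ₂
    1≉0             : 1# ≉ 0#
    *-inverseʳ      : ∀ x → x ≉ 0# → x * x ⁻¹ ≈ 1#
    isDecTotalOrder : IsDecTotalOrder _≈_ _≤_
    +-monoˡ-≤       : ∀ z {x y} → x ≤ y → x + z ≤ y + z
    *-nonNeg        : ∀ {x y} → 0# ≤ x → 0# ≤ y → 0# ≤ x * y

  fromℕ : ℕ → Carrier
  fromℕ k = RawMonoidDefs._×_ +-rawMonoid k 1#

  field
    archimedean : ∀ x → ∃[ k ] x ≤ fromℕ k

  decTotalOrder : DecTotalOrder c ℓ₁ ℓ₂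
  decTotalOrder = record { isDecTotalOrder = isDecTotalOrder }

  open DecTotalOrder decTotalOrder public using (_≤?_; totalOrder)
  open ToStrict _≈_ _≤_ public using (_<_)

  abs : Op₁ Carrier
  abs x = Max._⊔_ totalOrder x (- x)

  TendsToZero : (ℕ → Carrier) → Set (c ⊔ ℓ₁ ⊔ ℓ₂)
  TendsToZero f = ∀ ε → 0# < ε → ∃[ N ] (∀ n → N ℕ.≤ n → abs (f n) < ε)

record Graph (n : ℕ) : Set where
  field
    adjacent    : Fin n → Fin n → Bool
    symmetric   : ∀ u v → adjacent u v ≡ adjacent v u
    irreflexive : ∀ v → adjacent v v ≡ false

  neighbours : Fin n → Subset n
  neighbours v = tabulate (adjacent v)

  Regular : ℕ → Set
  Regular d = ∀ v → ∣ neighbours v ∣ ≡ d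

module _ {c ℓ₁ ℓ₂} (K : ArchimedeanOrderedField c ℓ₁ ℓ₂) where
  open ArchimedeanOrderedField K

  robustNeighbourhood : ∀ {n} → Carrier → Graph n → Subset n → Subset n
  robustNeighbourhood {n} ν G S =
    tabulate λ v → does (ν * fromℕ n ≤? fromℕ ∣ Graph.neighbours G v ∩ S ∣)

  RobustExpander : ∀ {n} → Carrier → Carrier → Graph n → Set ℓ₂
  RobustExpander {n} ν τ G = ∀ (S : Subset n) →
    τ * fromℕ n ≤ fromℕ ∣ S ∣ →
    fromℕ ∣ S ∣ ≤ (1# - τ) * fromℕ n →
    fromℕ ∣ S ∣ + ν * fromℕ n ≤ fromℕ ∣ robustNeighbourhood ν G S ∣

  -- Probability of P for a uniformly random entry of xs; meaningful only when
  -- xs is nonempty, and xs should list each outcome once.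
  uniformProbability : ∀ {a p} {A : Set a} {P : Pred A p} →
                       List A → Decidable P → Carrier
  uniformProbability xs P? =
    fromℕ (length (filter P? xs)) * fromℕ (length xs) ⁻¹

-- An undirected edge is represented by its endpoints in increasing order.
Edge : ℕ → Set
Edge n = Fin n × Fin n

_≟ᴱ_ : ∀ {n} → DecidableEquality (Edge n)
_≟ᴱ_ = ≡-dec Fin._≟_ Fin._≟_

_∈?_ : ∀ {n} (e : Edge n) (M : List (Edge n)) → Dec (e ∈ M)
_∈?_ = DecMembership._∈?_ _≟ᴱ_

-- Lists every edge exactly once.
edges : ∀ {n} → Graph n → List (Edge n)
edges {n} G =
  filter (λ (u , v) → (u Fin.<? v) ×-dec (Graph.adjacent G u v Bool.≟ true))
         (cartesianProduct (allFin n) (allFin n))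

-- For xs without repetitions, lists each subset of the entries of xs exactly
-- once, as a sublist of xs.
subsets : ∀ {a} {A : Set a} → List A → List (List A)
subsets []       = [] ∷ []
subsets (x ∷ xs) = map (x ∷_) (subsets xs) ++ subsets xs

Incident : ∀ {n} → Fin n → Edge n → Set
Incident v (u , w) = v ≡ u ⊎ v ≡ w

incident? : ∀ {n} (v : Fin n) → Decidable (Incident v)
incident? v (u , w) = (v Fin.≟ u) ⊎-dec (v Fin.≟ w)

-- Every vertex lies in exactly one edge of M.
IsPerfectMatching : ∀ {n} → List (Edge n) → Set
IsPerfectMatching M = ∀ v → length (filter (incident? v) M) ≡ 1

isPerfectMatching? : ∀ {n} → Decidable (IsPerfectMatching {n})
isPerfectMatching? M =
  Fin.all? λ v → length (filter (incident? v) M) ℕ.≟ 1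

perfectMatchings : ∀ {n} → Graph n → List (List (Edge n))
perfectMatchings G = filter isPerfectMatching? (subsets (edges G))

-- Write a perfect matching as the involution σ exchanging the ends of its
-- edges. Walks that alternate between edges of G and pairs {w, σ w} form a
-- doubly stochastic chain. Robust expansion makes the set reached from any
-- vertex grow by a fixed proportion of n per step until it is everything, so
-- any two vertices are joined by a positive proportion of the expected number
-- of walks after boundedly many steps, and by Doeblin's argument the number of
-- walks with j pairs between any two vertices is (1 ± ε) d ^ (j + 1) / n for
-- large constant j. Only O(d ^ (j − 1)) of these walks repeat a vertex.
--
-- Let e = uv. A cycle of length 2 j + 4 through e alternating for a matching
-- that contains e is the same as one alternating for the matching, not
-- containing e, obtained by switching along it. A matching containing e lies on
-- about d ^ (j + 2) / n such cycles, any other one on about d ^ (j + 1) / n, so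
-- the former are fewer than the latter by a factor of about d. A long walk
-- between two uncovered vertices also gives an augmenting path, which yields
-- the existence of a perfect matching.
module Submission where

open import Defs
import Algebra.Construct.NaturalChoice.Max as Max
import Algebra.Construct.NaturalChoice.MaxOp as MaxOp
import Algebra.Properties.CommutativeSemigroup as CommutativeSemigroupProperties
import Algebra.Properties.Ring as RingProperties
import Algebra.Properties.Semiring.Mult as SemiringMult
open import Data.Bool.Base using (Bool; true; false)
open import Data.Empty using (⊥; ⊥-elim)
open import Data.Fin.Base using (Fin)
open import Data.Fin.Subset using (_∩_; ∣_∣)
open import Data.List.Base using ([]; length; filter)
open import Data.List.Membership.Propositional using (_∈_)
open import Data.Nat.Base using (ℕ; zero; suc)
open import Data.Nat.Divisibility using (_∣_)
open import Data.Product.Base using (_×_; Σ-syntax; ∃-syntax; _,_; proj₁; proj₂)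
open import Data.Sum.Base using (inj₁; inj₂)
open import Data.Vec.Base using (tabulate)
open import Relation.Binary.Bundles using (DecTotalOrder)
open import Relation.Binary.PropositionalEquality using (_≢_)
import Relation.Binary.PropositionalEquality as ≡
import Relation.Binary.Reasoning.PartialOrder as PartialOrderReasoning
open import Relation.Nullary.Decidable using (Dec; does; yes; no)
open import Relation.Nullary.Negation using (¬_)
import Data.Nat.Base as ℕ
import Data.Nat.Properties as ℕₚ

-- All counting is done over ℕ with denominators cleared: δ and ν enter only through integers with 1
-- ≤ δ D and 1 ≤ ν N. The choice τ = 1 / (2 D) lets the growth run its full course: the first set is
-- a neighbourhood, with at least n / D vertices, and a set missing fewer than n / (2 D) vertices
-- still meets every neighbourhood in more than n / (2 D) vertices.
--
-- Mixing is proved for an arbitrary involution σ, fixed points included. So it also covers partial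
-- matchings, whose fixed points are the uncovered vertices, and its constants depend neither on n
-- nor on σ. This uniformity is what allows the walk counts to be summed over all matchings.
--
-- Cycles are never handled as objects. Revealing the partners of the path vertices one at a time
-- turns the sum over matchings containing e and the sum over the others into the same number `R`,
-- which forgets which edges of the path came from the matching.
--
-- The constants are chosen in the order D, N, accuracy K, walk length, n. The function η arises by
-- letting K increase with n as fast as the lower bound on n permits.

module Counting where
  open import Data.Bool.Base using (_∨_; not)
  open import Data.Bool.Properties using () renaming (_≟_ to _≟ᵇ_)
  open import Data.Fin.Base using (zero; suc)
  import Data.Fin.Base as Fin
  open import Data.Fin.Properties using (all?) renaming (_≟_ to _≟ꟳ_)
  import Data.Fin.Properties as Finₚ
  open import Data.List.Base using (List; _∷_; _++_; map; allFin; cartesianProduct; cartesianProductWith)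
  import Data.List.Membership.DecPropositional as DecMembership
  open import Data.List.Membership.Propositional using (_∉_)
  open import Data.List.Membership.Propositional.Properties
  open import Data.List.Properties using (filter-≐; length-tabulate; map-tabulate; ∷-injectiveʳ)
  open import Data.List.Relation.Binary.Permutation.Propositional using (_↭_; ↭-sym; ↭-prep; ↭⇒↭ₛ)
  open import Data.List.Relation.Binary.Permutation.Propositional.Properties using (shift; ∈-resp-↭; ↭-length) renaming (map⁺ to ↭-map⁺)
  open import Data.List.Relation.Binary.Permutation.Setoid.Properties using (Unique-resp-↭)
  open import Data.List.Relation.Binary.Subset.Propositional using (_⊆_)
  open import Data.List.Relation.Unary.All using (All; []; _∷_)
  import Data.List.Relation.Unary.All as All
  open import Data.List.Relation.Unary.AllPairs using ([]; _∷_)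
  open import Data.List.Relation.Unary.Any using (here; there)
  open import Data.List.Relation.Unary.Unique.Propositional using (Unique)
  open import Data.List.Relation.Unary.Unique.Propositional.Properties
    using (++⁺; allFin⁺; cartesianProduct⁺; cartesianProductWith⁺; filter⁺)
  open import Data.Nat.Base
  open import Data.Nat.Divisibility using (divides)
  open import Data.Nat.ListAction using (sum)
  open import Data.Nat.ListAction.Properties using (sum-↭)
  open import Data.Nat.Properties
  open import Data.Nat.Tactic.RingSolver using (solve-∀)
  open import Data.Sum.Base using (_⊎_; [_,_]′)
  open import Data.Vec.Base using (Vec; []; _∷_; lookup)
  open import Data.Vec.Properties using (lookup∘tabulate; tabulate∘lookup; tabulate-cong; ∷-injective)
  open import Function.Base using (_∘_; id)
  open import Relation.Binary.Definitions using (DecidableEquality; tri<; tri≈; tri>)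
  open import Relation.Binary.PropositionalEquality
    using (_≡_; refl; sym; trans; cong; cong₂; subst; setoid; module ≡-Reasoning)
  open import Relation.Nullary.Decidable using (¬?; _×-dec_; _→-dec_)
  open import Relation.Unary using (Pred; Decidable)

  -- Finite sums

  𝟙 : Bool → ℕ
  𝟙 true  = 1
  𝟙 false = 0

  𝟙≤1 : ∀ b → 𝟙 b ≤ 1
  𝟙≤1 true  = ≤-refl
  𝟙≤1 false = z≤n

  [_] : ∀ {p} {P : Set p} → Dec P → ℕ
  [ P? ] = 𝟙 (does P?)

  []-true : ∀ {p} {P : Set p} (P? : Dec P) → P → [ P? ] ≡ 1
  []-true (yes _) p = refl
  []-true (no ¬p) p = ⊥-elim (¬p p)

  []-false : ∀ {p} {P : Set p} (P? : Dec P) → ¬ P → [ P? ] ≡ 0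
  []-false (yes p) ¬p = ⊥-elim (¬p p)
  []-false (no _)  ¬p = refl

  []-cong : ∀ {p q} {P : Set p} {Q : Set q} (P? : Dec P) (Q? : Dec Q) → (P → Q) → (Q → P) → [ P? ] ≡ [ Q? ]
  []-cong (yes p) Q? f g = sym ([]-true Q? (f p))
  []-cong (no ¬p) Q? f g = sym ([]-false Q? (¬p ∘ g))

  module _ {a} {A : Set a} where

    ∑ : List A → (A → ℕ) → ℕ
    ∑ []       f = 0
    ∑ (x ∷ xs) f = f x + ∑ xs f

    infix 8 ∑
    syntax ∑ xs (λ x → e) = ∑[ x ∈ xs ] e

    ∑-cong-∈ : ∀ xs {f g : A → ℕ} → (∀ x → x ∈ xs → f x ≡ g x) → ∑ xs f ≡ ∑ xs g
    ∑-cong-∈ []       h = refl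
    ∑-cong-∈ (x ∷ xs) h = cong₂ _+_ (h x (here refl)) (∑-cong-∈ xs (λ y → h y ∘ there))

    ∑-cong : ∀ xs {f g : A → ℕ} → (∀ x → f x ≡ g x) → ∑ xs f ≡ ∑ xs g
    ∑-cong xs h = ∑-cong-∈ xs (λ x _ → h x)

    ∑-mono-∈ : ∀ xs {f g : A → ℕ} → (∀ x → x ∈ xs → f x ≤ g x) → ∑ xs f ≤ ∑ xs g
    ∑-mono-∈ []       h = z≤n
    ∑-mono-∈ (x ∷ xs) h = +-mono-≤ (h x (here refl)) (∑-mono-∈ xs (λ y → h y ∘ there))

    ∑-mono : ∀ xs {f g : A → ℕ} → (∀ x → f x ≤ g x) → ∑ xs f ≤ ∑ xs g
    ∑-mono xs h = ∑-mono-∈ xs (λ x _ → h x)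

    ∑-const : ∀ xs c → ∑[ x ∈ xs ] c ≡ length xs * c
    ∑-const []       c = refl
    ∑-const (x ∷ xs) c = cong (c +_) (∑-const xs c)

    ∑-zero : ∀ xs → ∑[ x ∈ xs ] 0 ≡ 0
    ∑-zero xs = trans (∑-const xs 0) (*-zeroʳ (length xs))

    ∑-+ : ∀ xs (f g : A → ℕ) → ∑[ x ∈ xs ] (f x + g x) ≡ ∑ xs f + ∑ xs g
    ∑-+ []       f g = refl
    ∑-+ (x ∷ xs) f g = begin
      f x + g x + ∑[ y ∈ xs ] (f y + g y)   ≡⟨ cong (f x + g x +_) (∑-+ xs f g) ⟩
      f x + g x + (∑ xs f + ∑ xs g)         ≡⟨ lemma (f x) (g x) (∑ xs f) (∑ xs g) ⟩
      f x + ∑ xs f + (g x + ∑ xs g)         ∎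
      where
      open ≡-Reasoning
      lemma : ∀ a b c d → a + b + (c + d) ≡ a + c + (b + d)
      lemma = solve-∀

    ∑-*ˡ : ∀ xs c (f : A → ℕ) → ∑[ x ∈ xs ] (c * f x) ≡ c * ∑ xs f
    ∑-*ˡ []       c f = sym (*-zeroʳ c)
    ∑-*ˡ (x ∷ xs) c f = trans (cong (c * f x +_) (∑-*ˡ xs c f)) (sym (*-distribˡ-+ c (f x) (∑ xs f)))

    ∑-*ʳ : ∀ xs c (f : A → ℕ) → ∑[ x ∈ xs ] (f x * c) ≡ ∑ xs f * c
    ∑-*ʳ xs c f = trans (∑-cong xs (λ x → *-comm (f x) c)) (trans (∑-*ˡ xs c f) (*-comm c (∑ xs f)))

    ∑-↭ : ∀ {xs ys} (f : A → ℕ) → xs ↭ ys → ∑ xs f ≡ ∑ ys f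
    ∑-↭ {xs} {ys} f p = trans (∑-sum xs) (trans (sum-↭ (↭-map⁺ f p)) (sym (∑-sum ys)))
      where
      ∑-sum : ∀ xs → ∑ xs f ≡ sum (map f xs)
      ∑-sum []       = refl
      ∑-sum (x ∷ xs) = cong (f x +_) (∑-sum xs)

    ∑-⊆ : ∀ {xs ys} (f : A → ℕ) → Unique xs → xs ⊆ ys → ∑ xs f ≤ ∑ ys f
    ∑-⊆ {[]}     f u sub = z≤n
    ∑-⊆ {x ∷ xs} f (x∉ ∷ u) sub with ∈-∃++ (sub (here refl))
    ... | as , bs , refl = begin
      f x + ∑ xs f           ≤⟨ +-monoʳ-≤ (f x) (∑-⊆ f u sub′) ⟩
      f x + ∑ (as ++ bs) f   ≡⟨ ∑-↭ f (shift x as bs) ⟨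
      ∑ (as ++ x ∷ bs) f     ∎
      where
      open ≤-Reasoning
      sub′ : xs ⊆ as ++ bs
      sub′ y∈ with ∈-resp-↭ (shift x as bs) (sub (there y∈))
      ... | here refl = ⊥-elim (All.lookup x∉ y∈ refl)
      ... | there y∈′ = y∈′

    ∑-filter : ∀ {p} {P : Pred A p} (P? : Decidable P) xs (f : A → ℕ) →
               ∑ (filter P? xs) f ≡ ∑[ x ∈ xs ] ([ P? x ] * f x)
    ∑-filter P? []       f = refl
    ∑-filter P? (x ∷ xs) f with does (P? x)
    ... | true  = cong₂ _+_ (sym (+-identityʳ (f x))) (∑-filter P? xs f)
    ... | false = ∑-filter P? xs f

    length-filter-≡-∑ : ∀ {p} {P : Pred A p} (P? : Decidable P) xs → length (filter P? xs) ≡ ∑[ x ∈ xs ]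
        [ P? x ]
    length-filter-≡-∑ P? xs = begin
      length (filter P? xs)           ≡⟨ *-identityʳ _ ⟨
      length (filter P? xs) * 1       ≡⟨ ∑-const (filter P? xs) 1 ⟨
      ∑[ x ∈ filter P? xs ] 1         ≡⟨ ∑-filter P? xs (λ _ → 1) ⟩
      ∑[ x ∈ xs ] ([ P? x ] * 1)      ≡⟨ ∑-cong xs (λ x → *-identityʳ _) ⟩
      ∑[ x ∈ xs ] [ P? x ]            ∎
      where open ≡-Reasoning

    ∑-positive : ∀ xs (f : A → ℕ) → 0 < ∑ xs f → ∃[ x ] x ∈ xs × 0 < f x
    ∑-positive (x ∷ xs) f pos with f x in eq
    ... | suc _ = x , here refl , subst (0 <_) (sym eq) z<s
    ... | zero  with ∑-positive xs f pos
    ...   | y , y∈ , p = y , there y∈ , p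

    ∑-delta : (_≟ᴬ_ : DecidableEquality A) → ∀ {xs a} → Unique xs → a ∈ xs → (f : A → ℕ) →
              ∑[ x ∈ xs ] ([ a ≟ᴬ x ] * f x) ≡ f a
    ∑-delta _≟ᴬ_ {x ∷ xs} {a} (x∉ ∷ u) (here refl) f = begin
      [ a ≟ᴬ a ] * f a + ∑[ y ∈ xs ] ([ a ≟ᴬ y ] * f y)
        ≡⟨ cong₂ _+_ (cong (_* f a) ([]-true (a ≟ᴬ a) refl))
                     (∑-cong-∈ xs λ y y∈ → cong (_* f y) ([]-false (a ≟ᴬ y) (All.lookup x∉ y∈))) ⟩
      1 * f a + ∑[ y ∈ xs ] 0     ≡⟨ cong₂ _+_ (*-identityˡ (f a)) (∑-zero xs) ⟩
      f a + 0                     ≡⟨ +-identityʳ (f a) ⟩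
      f a                         ∎
      where open ≡-Reasoning
    ∑-delta _≟ᴬ_ {x ∷ xs} {a} (x∉ ∷ u) (there a∈) f =
      cong₂ _+_ (cong (_* f x) ([]-false (a ≟ᴬ x) (All.lookup x∉ a∈ ∘ sym))) (∑-delta _≟ᴬ_ u a∈ f)

  module _ {a b} {A : Set a} {B : Set b} where

    ∑-map : ∀ (h : A → B) xs (f : B → ℕ) → ∑ (map h xs) f ≡ ∑[ x ∈ xs ] f (h x)
    ∑-map h []       f = refl
    ∑-map h (x ∷ xs) f = cong (f (h x) +_) (∑-map h xs f)

    ∑-swap : ∀ xs ys (f : A → B → ℕ) → ∑[ x ∈ xs ] ∑[ y ∈ ys ] f x y ≡ ∑[ y ∈ ys ] ∑[ x ∈ xs ] f x y
    ∑-swap []       ys f = sym (∑-zero ys)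
    ∑-swap (x ∷ xs) ys f = begin
      ∑ ys (f x) + ∑[ x′ ∈ xs ] ∑[ y ∈ ys ] f x′ y    ≡⟨ cong (∑ ys (f x) +_) (∑-swap xs ys f) ⟩
      ∑ ys (f x) + ∑[ y ∈ ys ] ∑[ x′ ∈ xs ] f x′ y    ≡⟨ ∑-+ ys (f x) _ ⟨
      ∑[ y ∈ ys ] (f x y + ∑[ x′ ∈ xs ] f x′ y)       ∎
      where open ≡-Reasoning

    map-unique : ∀ (h : A → B) {xs} → (∀ {x y} → x ∈ xs → y ∈ xs → h x ≡ h y → x ≡ y) →
                 Unique xs → Unique (map h xs)
    map-unique h inj [] = []
    map-unique h {x ∷ xs} inj (x∉ ∷ u) =
      All.tabulate distinct ∷ map-unique h (λ p q → inj (there p) (there q)) u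
      where
      distinct : ∀ {z} → z ∈ map h xs → h x ≢ z
      distinct z∈ refl with ∈-map⁻ h z∈
      ... | y , y∈ , eq = All.lookup x∉ y∈ (inj (here refl) (there y∈) eq)

    ∑-injection : ∀ {xs ys} (h : A → B) (f : A → ℕ) (g : B → ℕ) → Unique xs →
                  (∀ {x} → x ∈ xs → h x ∈ ys × f x ≤ g (h x)) →
                  (∀ {x y} → x ∈ xs → y ∈ xs → h x ≡ h y → x ≡ y) →
                  ∑ xs f ≤ ∑ ys g
    ∑-injection {xs} {ys} h f g u into inj = begin
      ∑ xs f                  ≤⟨ ∑-mono-∈ xs (λ x x∈ → proj₂ (into x∈)) ⟩
      ∑[ x ∈ xs ] g (h x)     ≡⟨ ∑-map h xs g ⟨
      ∑ (map h xs) g          ≤⟨ ∑-⊆ g (map-unique h inj u) sub ⟩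
      ∑ ys g                  ∎
      where
      open ≤-Reasoning
      sub : map h xs ⊆ ys
      sub z∈ with ∈-map⁻ h z∈
      ... | x , x∈ , refl = proj₁ (into x∈)

  -- Antisymmetry of two injection bounds; no permutation between the two lists has to be exhibited.
  ∑-bijection : ∀ {a b} {A : Set a} {B : Set b} {xs : List A} {ys : List B}
                (h : A → B) (k : B → A) (f : A → ℕ) (g : B → ℕ) → Unique xs → Unique ys →
                (∀ {x} → x ∈ xs → h x ∈ ys × k (h x) ≡ x × f x ≡ g (h x)) →
                (∀ {y} → y ∈ ys → k y ∈ xs × h (k y) ≡ y) →
                ∑ xs f ≡ ∑ ys g
  ∑-bijection h k f g ux uy into from = ≤-antisym
    (∑-injection h f g ux (λ p → proj₁ (into p) , ≤-reflexive (proj₂ (proj₂ (into p))))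
      λ p q eq → trans (sym (proj₁ (proj₂ (into p)))) (trans (cong k eq) (proj₁ (proj₂ (into q)))))
    (∑-injection k g f uy (λ {y} p → proj₁ (from p) , ≤-reflexive
        (sym (trans (proj₂ (proj₂ (into (proj₁ (from p))))) (cong g (proj₂ (from p))))))
      λ p q eq → trans (sym (proj₂ (from p))) (trans (cong h eq) (proj₂ (from q))))

  -- Alternating walks

  infix 4 _∈ꟳ?_
  _∈ꟳ?_ : ∀ {n} (x : Fin n) (xs : List (Fin n)) → Dec (x ∈ xs)
  _∈ꟳ?_ = DecMembership._∈?_ _≟ꟳ_

  ∑-member : ∀ {a} {A : Set a} {x : A} {xs} (f : A → ℕ) → x ∈ xs → f x ≤ ∑ xs f
  ∑-member f (here refl) = m≤m+n _ _
  ∑-member f (there x∈)  = ≤-trans (∑-member f x∈) (m≤n+m _ _)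

  []-+-¬ : ∀ b → 𝟙 b + 𝟙 (not b) ≡ 1
  []-+-¬ true  = refl
  []-+-¬ false = refl

  module Graphs (n : ℕ) where

    V : List (Fin n)
    V = allFin n

    length-V : length V ≡ n
    length-V = length-tabulate id

    ∑-V-const : ∀ c → ∑[ x ∈ V ] c ≡ n * c
    ∑-V-const c = trans (∑-const V c) (cong (_* c) length-V)

    ∑-delta-V : ∀ a (f : Fin n → ℕ) → ∑[ x ∈ V ] ([ a ≟ꟳ x ] * f x) ≡ f a
    ∑-delta-V a = ∑-delta _≟ꟳ_ (allFin⁺ n) (∈-allFin a)

    ∑-involution : (σ : Fin n → Fin n) → (∀ x → σ (σ x) ≡ x) → ∀ f → ∑[ x ∈ V ] f (σ x) ≡ ∑ V f
    ∑-involution σ σσ f = ∑-bijection σ σ _ f (allFin⁺ n) (allFin⁺ n)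
      (λ {x} _ → ∈-allFin _ , σσ x , refl) (λ {x} _ → ∈-allFin _ , σσ x)

    ∑-∈-≤-length : ∀ F → ∑[ w ∈ V ] [ w ∈ꟳ? F ] ≤ length F
    ∑-∈-≤-length F = begin
      ∑[ w ∈ V ] [ w ∈ꟳ? F ]             ≡⟨ length-filter-≡-∑ (_∈ꟳ? F) V ⟨
      length (filter (_∈ꟳ? F) V)         ≡⟨ trans (∑-const (filter (_∈ꟳ? F) V) 1) (*-identityʳ _) ⟨
      ∑[ w ∈ filter (_∈ꟳ? F) V ] 1
          ≤⟨ ∑-⊆ _ (filter⁺ (_∈ꟳ? F) (allFin⁺ n)) (proj₂ ∘ ∈-filter⁻ (_∈ꟳ? F) {xs = V}) ⟩
      ∑[ w ∈ F ] 1                       ≡⟨ trans (∑-const F 1) (*-identityʳ _) ⟩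
      length F                           ∎
      where open ≤-Reasoning

    size : (Fin n → Bool) → ℕ
    size s = ∑[ x ∈ V ] 𝟙 (s x)

    size-complement : ∀ s → size s + size (not ∘ s) ≡ n
    size-complement s = begin
      size s + size (not ∘ s)                   ≡⟨ ∑-+ V (𝟙 ∘ s) (𝟙 ∘ not ∘ s) ⟨
      ∑[ x ∈ V ] (𝟙 (s x) + 𝟙 (not (s x)))      ≡⟨ ∑-cong V (λ x → []-+-¬ (s x)) ⟩
      ∑[ x ∈ V ] 1                              ≡⟨ ∑-V-const 1 ⟩
      n * 1                                     ≡⟨ *-identityʳ n ⟩
      n                                         ∎
      where open ≡-Reasoning

    size-full : ∀ s → n ≤ size s → ∀ x → s x ≡ true
    size-full s full x with s x in eq
    ... | true  = refl
    ... | false = ⊥-elim (<⇒≱ (m<m+n (size s) positive) (subst (_≤ size s) (sym (size-complement s)) full))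
      where
      positive : 0 < size (not ∘ s)
      positive = ≤-trans (≤-reflexive (sym (cong (𝟙 ∘ not) eq))) (∑-member (𝟙 ∘ not ∘ s) (∈-allFin x))

    -- Two averages of f with weights a and b of the same total A are compared
    -- through the double sum of a z * b z′.
    ∑-weighted-oscillation : ∀ (a b f : Fin n → ℕ) {A q o} → ∑ V a ≡ A → ∑ V b ≡ A →
                             (∀ z z′ → q * f z ≤ q * f z′ + o) →
                             q * ∑[ z ∈ V ] (a z * f z) ≤ q * ∑[ z ∈ V ] (b z * f z) + A * o
    ∑-weighted-oscillation a b f {zero} {q} {o} Σa Σb osc = begin
      q * ∑[ z ∈ V ] (a z * f z)     ≡⟨ cong (q *_) (∑-cong V λ z → cong (_* f z) (vanish z)) ⟩
      q * ∑[ z ∈ V ] 0               ≡⟨ cong (q *_) (∑-zero V) ⟩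
      q * 0                          ≡⟨ *-zeroʳ q ⟩
      0                              ≤⟨ z≤n ⟩
      q * ∑[ z ∈ V ] (b z * f z) + 0 ∎
      where
      open ≤-Reasoning
      vanish : ∀ z → a z ≡ 0
      vanish z = n≤0⇒n≡0 (≤-trans (∑-member a (∈-allFin z)) (≤-reflexive Σa))
    ∑-weighted-oscillation a b f {A@(suc _)} {q} {o} Σa Σb osc = *-cancelˡ-≤ A (begin
      A * (q * S a)
        ≡⟨ cong₂ _*_ (sym Σb) (sym (∑-*ˡ V q _)) ⟩
      ∑ V b * ∑[ z ∈ V ] (q * (a z * f z))
        ≡⟨ ∑-*ˡ V (∑ V b) _ ⟨
      ∑[ z ∈ V ] (∑ V b * (q * (a z * f z)))
        ≡⟨ ∑-cong V (λ z → sym (∑-*ʳ V (q * (a z * f z)) b)) ⟩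
      ∑[ z ∈ V ] ∑[ z′ ∈ V ] (b z′ * (q * (a z * f z)))
        ≡⟨ ∑-cong V (λ z → ∑-cong V λ z′ → shape₁ (b z′) q (a z) (f z)) ⟩
      ∑[ z ∈ V ] ∑[ z′ ∈ V ] (a z * b z′ * (q * f z))
        ≤⟨ ∑-mono V (λ z → ∑-mono V λ z′ → *-monoʳ-≤ (a z * b z′) (osc z z′)) ⟩
      ∑[ z ∈ V ] ∑[ z′ ∈ V ] (a z * b z′ * (q * f z′ + o))
        ≡⟨ ∑-cong V (λ z → trans (∑-cong V λ z′ → shape₂ (a z) (b z′) q (f z′) o) (∑-*ˡ V (a z) _)) ⟩
      ∑[ z ∈ V ] (a z * ∑[ z′ ∈ V ] (q * (b z′ * f z′) + b z′ * o))
        ≡⟨ ∑-*ʳ V _ a ⟩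
      ∑ V a * ∑[ z′ ∈ V ] (q * (b z′ * f z′) + b z′ * o)
        ≡⟨ cong₂ _*_ Σa (trans (∑-+ V _ _) (cong₂ _+_ (∑-*ˡ V q _) (trans (∑-*ʳ V o b) (cong (_* o) Σb)))) ⟩
      A * (q * S b + A * o) ∎)
      where
      open ≤-Reasoning
      S : (Fin n → ℕ) → ℕ
      S c = ∑[ z ∈ V ] (c z * f z)
      shape₁ : ∀ b q a f → b * (q * (a * f)) ≡ a * b * (q * f)
      shape₁ = solve-∀
      shape₂ : ∀ a b q f o → a * b * (q * f + o) ≡ a * (q * (b * f) + b * o)
      shape₂ = solve-∀

    adj : Graph n → Fin n → Fin n → ℕ
    adj G x y = 𝟙 (Graph.adjacent G x y)

    degreeInto : Graph n → (Fin n → Bool) → Fin n → ℕ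
    degreeInto G s x = ∑[ w ∈ V ] (adj G x w * 𝟙 (s w))

    IntRegular : ℕ → Graph n → Set
    IntRegular d G = ∀ x → ∑ V (adj G x) ≡ d

    rn : ℕ → Graph n → (Fin n → Bool) → Fin n → Bool
    rn N G s x = does (n ≤? N * degreeInto G s x)

    -- Robust (1/N, 1/T)-expansion with denominators cleared.
    IntRobust : ℕ → ℕ → Graph n → Set
    IntRobust N T G = ∀ s → n ≤ T * size s → T * size s + n ≤ T * n → N * size s + n ≤ N * size (rn N G s)

    module Walks (G : Graph n) (σ : Fin n → Fin n) where

      A : Fin n → Fin n → ℕ
      A = adj G

      -- Walks that alternate between edges of G and pairs {w, σ w}, with j pairs.
      W : ℕ → Fin n → Fin n → ℕ
      W zero    x y = A x y
      W (suc j) x y = ∑[ w ∈ V ] (A x w * W j (σ w) y)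

      -- The walks of `W` that use no vertex of `F` and no pair twice. Only `w` is tested: when `F`
      -- is closed under the involution `σ`, the partner `σ w` lies outside `F` together with `w`.
      -- The end `y` is kept off the inner vertices by listing it in `F`.
      P : ℕ → List (Fin n) → Fin n → Fin n → ℕ
      P zero    F x y = A x y
      P (suc j) F x y = ∑[ w ∈ V ] (A x w * ([ ¬? (w ∈ꟳ? F) ] * P j (σ w ∷ w ∷ F) (σ w) y))

      P≤W : ∀ j F x y → P j F x y ≤ W j x y
      P≤W zero    F x y = ≤-refl
      P≤W (suc j) F x y = ∑-mono V λ w → *-monoʳ-≤ (A x w) (begin
        [ ¬? (w ∈ꟳ? F) ] * P j (σ w ∷ w ∷ F) (σ w) y
            ≤⟨ *-mono-≤ (𝟙≤1 (does (¬? (w ∈ꟳ? F)))) (P≤W j _ (σ w) y) ⟩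
        1 * W j (σ w) y                                ≡⟨ *-identityˡ _ ⟩
        W j (σ w) y                                    ∎)
        where open ≤-Reasoning

      W-concat : ∀ i j x y → W (suc (i + j)) x y ≡ ∑[ w ∈ V ] (W i x w * W j (σ w) y)
      W-concat zero    j x y = refl
      W-concat (suc i) j x y = begin
        ∑[ w ∈ V ] (A x w * W (suc (i + j)) (σ w) y)
          ≡⟨ ∑-cong V (λ w → trans (cong (A x w *_) (W-concat i j (σ w) y)) (sym (∑-*ˡ V (A x w) _))) ⟩
        ∑[ w ∈ V ] ∑[ u ∈ V ] (A x w * (W i (σ w) u * W j (σ u) y))
          ≡⟨ ∑-swap V V _ ⟩
        ∑[ u ∈ V ] ∑[ w ∈ V ] (A x w * (W i (σ w) u * W j (σ u) y))
          ≡⟨ ∑-cong V (λ u → trans (∑-cong V λ w → sym (*-assoc (A x w) _ _)) (∑-*ʳ V (W j (σ u) y) _)) ⟩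
        ∑[ u ∈ V ] (W (suc i) x u * W j (σ u) y) ∎
        where open ≡-Reasoning

      module _ {d : ℕ} (regular : IntRegular d G) where

        W≤d^j : ∀ j x y → W j x y ≤ d ^ j
        W≤d^j zero    x y = 𝟙≤1 _
        W≤d^j (suc j) x y = begin
          ∑[ w ∈ V ] (A x w * W j (σ w) y)   ≤⟨ ∑-mono V (λ w → *-monoʳ-≤ (A x w) (W≤d^j j (σ w) y)) ⟩
          ∑[ w ∈ V ] (A x w * d ^ j)         ≡⟨ ∑-*ʳ V (d ^ j) (A x) ⟩
          ∑ V (A x) * d ^ j                  ≡⟨ cong (_* d ^ j) (regular x) ⟩
          d * d ^ j                          ∎
          where open ≤-Reasoning

        W-row-sum : ∀ j x → ∑ V (W j x) ≡ d ^ suc j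
        W-row-sum zero    x = trans (regular x) (sym (*-identityʳ d))
        W-row-sum (suc j) x = begin
          ∑[ y ∈ V ] ∑[ w ∈ V ] (A x w * W j (σ w) y)   ≡⟨ ∑-swap V V _ ⟩
          ∑[ w ∈ V ] ∑[ y ∈ V ] (A x w * W j (σ w) y)
              ≡⟨ ∑-cong V (λ w → trans (∑-*ˡ V (A x w) _) (cong (A x w *_) (W-row-sum j (σ w)))) ⟩
          ∑[ w ∈ V ] (A x w * d ^ suc j)                ≡⟨ ∑-*ʳ V (d ^ suc j) (A x) ⟩
          ∑ V (A x) * d ^ suc j                         ≡⟨ cong (_* d ^ suc j) (regular x) ⟩
          d * d ^ suc j                                 ∎
          where open ≡-Reasoning

        -- A union bound over the first repeated or forbidden vertex, multiplied by d to
        -- avoid the exponent j − 1.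
        W≤P+error : ∀ j F x y → d * W j x y ≤ d * P j F x y + j * (length F + 2 * j) * d ^ j
        W≤P+error zero    F x y = m≤m+n _ _
        W≤P+error (suc j) F x y = begin
          d * ∑[ w ∈ V ] (A x w * W j (σ w) y)
            ≡⟨ ∑-*ˡ V d _ ⟨
          ∑[ w ∈ V ] (d * (A x w * W j (σ w) y))
            ≤⟨ ∑-mono V (λ w → ≤-trans (≤-reflexive (shape₁ d (A x w) (W j (σ w) y)))
                (*-monoʳ-≤ (A x w) (step w))) ⟩
          ∑[ w ∈ V ] (A x w * (d * Q w + (e + [ w ∈ꟳ? F ] * d ^ suc j)))
            ≤⟨ ∑-mono V (λ w → ≤-trans (≤-reflexive (shape₂ (A x w) d (Q w) e _))
                (+-monoʳ-≤ (d * (A x w * Q w)) (+-monoʳ-≤ (A x w * e)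
                (*-monoˡ-≤ _ (𝟙≤1 (Graph.adjacent G x w)))))) ⟩
          ∑[ w ∈ V ] (d * (A x w * Q w) + (A x w * e + 1 * ([ w ∈ꟳ? F ] * d ^ suc j)))
            ≡⟨ trans (∑-+ V _ _) (cong₂ _+_ (∑-*ˡ V d _)
                (trans (∑-+ V _ _) (cong₂ _+_ (trans (∑-*ʳ V e (A x)) (cong (_* e) (regular x)))
                (trans (∑-*ˡ V 1 _) (trans (*-identityˡ _) (∑-*ʳ V (d ^ suc j) _)))))) ⟩
          d * P (suc j) F x y + (d * e + ∑[ w ∈ V ] [ w ∈ꟳ? F ] * d ^ suc j)
            ≤⟨ +-monoʳ-≤ (d * P (suc j) F x y) (+-monoʳ-≤ (d * e) (*-monoˡ-≤ (d ^ suc j) (∑-∈-≤-length F)))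
                ⟩
          d * P (suc j) F x y + (d * e + f * d ^ suc j)
            ≤⟨ +-monoʳ-≤ (d * P (suc j) F x y)
                (≤-trans (m≤m+n _ ((2 + 2 * j) * d ^ suc j)) (≤-reflexive (shape₃ d j f (d ^ j)))) ⟩
          d * P (suc j) F x y + suc j * (f + 2 * suc j) * d ^ suc j ∎
          where
          open ≤-Reasoning
          f e : ℕ
          f = length F
          e = j * (2 + f + 2 * j) * d ^ j
          Q : Fin n → ℕ
          Q w = [ ¬? (w ∈ꟳ? F) ] * P j (σ w ∷ w ∷ F) (σ w) y
          step : ∀ w → d * W j (σ w) y ≤ d * Q w + (e + [ w ∈ꟳ? F ] * d ^ suc j)
          step w with w ∈ꟳ? F
          ... | yes _ = ≤-trans (*-monoʳ-≤ d (W≤d^j j (σ w) y))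
              (≤-trans (≤-reflexive (sym (*-identityˡ _))) (≤-trans (m≤n+m _ e) (m≤n+m _ (d * 0))))
          ... | no  _ = ≤-trans (W≤P+error j (σ w ∷ w ∷ F) (σ w) y)
              (≤-reflexive (cong₂ _+_ (cong (d *_) (sym (*-identityˡ _))) (sym (+-identityʳ e))))
          shape₁ : ∀ d a w → d * (a * w) ≡ a * (d * w)
          shape₁ = solve-∀
          shape₂ : ∀ a d q e t → a * (d * q + (e + t)) ≡ d * (a * q) + (a * e + a * t)
          shape₂ = solve-∀
          shape₃ : ∀ d j f p → d * (j * (2 + f + 2 * j) * p) + f * (d * p) + (2 + 2 * j) * (d * p) ≡ suc j *
              (f + 2 * suc j) * (d * p)
          shape₃ = solve-∀

  -- Mixing

  private
    does-true : ∀ {p} {P : Set p} (P? : Dec P) → does P? ≡ true → P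
    does-true (yes p) _ = p

  module Mixing (n : ℕ) where
    open Graphs n

    module _ (G : Graph n) (σ : Fin n → Fin n) (σσ : ∀ x → σ (σ x) ≡ x) where
      open Walks G σ

      W-column-sum : ∀ {d} → IntRegular d G → (∀ x y → A x y ≡ A y x) →
                     ∀ j y → ∑[ x ∈ V ] W j x y ≡ d ^ suc j
      W-column-sum {d} regular sym-A zero y = trans (∑-cong V (λ x → sym-A x y)) (W-row-sum regular zero y)
      W-column-sum {d} regular sym-A (suc j) y = begin
        ∑[ x ∈ V ] ∑[ w ∈ V ] (A x w * W j (σ w) y)   ≡⟨ ∑-swap V V _ ⟩
        ∑[ w ∈ V ] ∑[ x ∈ V ] (A x w * W j (σ w) y)
            ≡⟨ ∑-cong V (λ w → trans (∑-*ʳ V (W j (σ w) y) _)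
            (cong (_* W j (σ w) y) (trans (∑-cong V (λ x → sym-A x w)) (regular w)))) ⟩
        ∑[ w ∈ V ] (d * W j (σ w) y)                  ≡⟨ ∑-*ˡ V d _ ⟩
        d * ∑[ w ∈ V ] W j (σ w) y                    ≡⟨ cong (d *_) (∑-involution σ σσ (λ w → W j w y)) ⟩
        d * ∑[ w ∈ V ] W j w y                        ≡⟨ cong (d *_) (W-column-sum regular sym-A j y) ⟩
        d * d ^ suc j                                 ∎
        where open ≡-Reasoning

      module _ (sym-A : ∀ x y → A x y ≡ A y x) {d : ℕ} (regular : IntRegular d G) where

        -- The set reach i of vertices ending many walks of W i from x grows by n / N
        -- per step until it contains more than n − n / (2 D) vertices, at which
        -- point the degree d ≥ n / D makes the next one everything.
        module Spread (D N : ℕ) (robust : IntRobust N (2 * D) G)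
                      (n≤Dd : n ≤ D * d) (2D≤N : 2 * D ≤ N) .{{_ : NonZero D}} (x : Fin n) where

          reach : ℕ → Fin n → Bool
          reach zero    = Graph.adjacent G x
          reach (suc i) = rn N G (reach i ∘ σ)

          reach⇒many-walks : ∀ i z → 𝟙 (reach i z) * n ^ i ≤ N ^ i * W i x z
          reach⇒many-walks zero z = ≤-reflexive (trans (*-identityʳ _) (sym (*-identityˡ _)))
          reach⇒many-walks (suc i) z with reach (suc i) z in eq
          ... | false = z≤n
          ... | true  = begin
            1 * (n * n ^ i)
              ≡⟨ *-identityˡ _ ⟩
            n * n ^ i
              ≤⟨ *-monoˡ-≤ (n ^ i) (does-true (n ≤? _) eq) ⟩
            N * ∑[ w ∈ V ] (A z w * 𝟙 (reach i (σ w))) * n ^ i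
              ≡⟨ trans (*-assoc N _ _) (cong (N *_)
                  (trans (sym (∑-*ʳ V (n ^ i) _)) (∑-cong V λ w → *-assoc (A z w) _ _))) ⟩
            N * ∑[ w ∈ V ] (A z w * (𝟙 (reach i (σ w)) * n ^ i))
              ≤⟨ *-monoʳ-≤ N (∑-mono V λ w → *-monoʳ-≤ (A z w) (reach⇒many-walks i (σ w))) ⟩
            N * ∑[ w ∈ V ] (A z w * (N ^ i * W i x (σ w)))
              ≡⟨ cong (N *_) (trans (∑-cong V λ w → shape (A z w) (N ^ i) (W i x (σ w))) (∑-*ˡ V (N ^ i) _))
                  ⟩
            N * (N ^ i * ∑[ w ∈ V ] (W i x (σ w) * A z w))
              ≡⟨ *-assoc N _ _ ⟨
            N ^ suc i * ∑[ w ∈ V ] (W i x (σ w) * A z w)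
              -- `reach` grows at the far end of the walk, whereas `W` recurses at its start.
              -- Reversing the edge `z w` and reindexing by `σ` produces the case `j = 0` of
              -- `W-concat`.
              ≡⟨ cong (N ^ suc i *_) (trans (∑-cong V λ w → cong (W i x (σ w) *_)
                  (trans (sym-A z w) (cong (λ u → A u z) (sym (σσ w)))))
                                            (trans (∑-involution σ σσ (λ w → W i x w * A (σ w) z))
                                                (sym (W-concat i 0 x z)))) ⟩
            N ^ suc i * W (suc (i + 0)) x z
              ≡⟨ cong (λ k → N ^ suc i * W (suc k) x z) (+-identityʳ i) ⟩
            N ^ suc i * W (suc i) x z ∎
            where
            open ≤-Reasoning
            shape : ∀ a b c → a * (b * c) ≡ b * (c * a)
            shape = solve-∀

          size-rn-dense : ∀ s → 2 * D * n < 2 * D * size s + n → size (rn N G s) ≡ n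
          size-rn-dense s dense = begin-equality
            size (rn N G s)   ≡⟨ ∑-cong V (λ z → []-true (n ≤? N * degreeInto G s z) (full z)) ⟩
            ∑[ z ∈ V ] 1      ≡⟨ ∑-V-const 1 ⟩
            n * 1             ≡⟨ *-identityʳ n ⟩
            n                 ∎
            where
            open ≤-Reasoning
            c : ℕ
            c = size (not ∘ s)
            few : 2 * D * c < n
            few = +-cancelˡ-< (2 * D * size s) _ _ (subst (_< 2 * D * size s + n)
              (trans (cong (2 * D *_) (sym (size-complement s))) (*-distribˡ-+ (2 * D) (size s) c)) dense)
            split : ∀ z w → A z w ≤ A z w * 𝟙 (s w) + 𝟙 (not (s w))
            split z w with s w
            ... | true  = ≤-reflexive (trans (sym (*-identityʳ _)) (sym (+-identityʳ _)))
            ... | false = ≤-trans (𝟙≤1 _) (m≤n+m 1 (A z w * 0))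
            degree : ∀ z → d ≤ degreeInto G s z + c
            degree z = begin
              d                                                     ≡⟨ regular z ⟨
              ∑ V (A z)                                             ≤⟨ ∑-mono V (split z) ⟩
              ∑[ w ∈ V ] (A z w * 𝟙 (s w) + 𝟙 (not (s w)))          ≡⟨ ∑-+ V _ _ ⟩
              degreeInto G s z + c                                  ∎
            full : ∀ z → n ≤ N * degreeInto G s z
            -- `n≤Dd` is used twice: one copy of `n` absorbs the loss from the `c` vertices missing
            -- from `s`, the other is left as the bound.
            full z = ≤-trans (+-cancelʳ-≤ n _ _ (begin
              n + n                                    ≤⟨ +-mono-≤ n≤Dd n≤Dd ⟩
              D * d + D * d
                  ≤⟨ +-mono-≤ (*-monoʳ-≤ D (degree z)) (*-monoʳ-≤ D (degree z)) ⟩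
              D * (e + c) + D * (e + c)                ≡⟨ shape D e c ⟩
              2 * D * e + 2 * D * c                    ≤⟨ +-monoʳ-≤ (2 * D * e) (<⇒≤ few) ⟩
              2 * D * e + n                            ∎)) (*-monoˡ-≤ e 2D≤N)
              where
              e : ℕ
              e = degreeInto G s z
              shape : ∀ D e c → D * (e + c) + D * (e + c) ≡ 2 * D * e + 2 * D * c
              shape = solve-∀

          -- The first component keeps the lower size condition of `IntRobust` available at every
          -- step. The second records growth by `n / N` per step, with the full set as the
          -- alternative because growth stops there.
          Large : ℕ → ℕ → Set
          Large i s = n ≤ 2 * D * s × (i * n ≤ N * s ⊎ n ≤ s)

          reach-large : ∀ i → Large i (size (reach i))
          reach-large zero = ≤-trans n≤Dd
              (≤-trans (*-monoˡ-≤ d (m≤m+n D (D + 0))) (≤-reflexive (cong (2 * D *_) (sym (regular x))))) ,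
              inj₁ z≤n
          reach-large (suc i) with reach-large i | 2 * D * size (reach i) + n ≤? 2 * D * n
          ... | _ | no dense = ≤-trans (m≤n*m n (2 * D) {{m*n≢0 2 D}})
              (≤-reflexive (cong (2 * D *_) (sym full))) , inj₂ (≤-reflexive (sym full))
            where
            full : size (reach (suc i)) ≡ n
            full = size-rn-dense (reach i ∘ σ)
              (subst (λ k → 2 * D * n < 2 * D * k + n) (sym (∑-involution σ σσ (𝟙 ∘ reach i))) (≰⇒> dense))
          ... | some , big | yes sparse = ≤-trans some (*-monoʳ-≤ (2 * D) s≤s′) , [_,_]′ (inj₁ ∘ next)
              (inj₂ ∘ already) big
            where
            s s′ : ℕ
            s = size (reach i)
            s′ = size (reach (suc i))
            2D>0 : 0 < 2 * D
            2D>0 = >-nonZero⁻¹ (2 * D) {{m*n≢0 2 D}}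
            expand : N * s + n ≤ N * s′
            expand = subst (λ k → N * k + n ≤ N * s′) eq
              (robust (reach i ∘ σ) (subst (λ k → n ≤ 2 * D * k) (sym eq) some)
                  (subst (λ k → 2 * D * k + n ≤ 2 * D * n) (sym eq) sparse))
              where
              eq : size (reach i ∘ σ) ≡ s
              eq = ∑-involution σ σσ (𝟙 ∘ reach i)
            s≤s′ : s ≤ s′
            s≤s′ = *-cancelˡ-≤ N {{>-nonZero (≤-trans 2D>0 2D≤N)}} (≤-trans (m≤m+n _ n) expand)
            next : i * n ≤ N * s → suc i * n ≤ N * s′
            next h = ≤-trans (+-monoʳ-≤ n h) (≤-trans (≤-reflexive (+-comm n _)) expand)
            already : n ≤ s → n ≤ s′
            already h = ≤-trans h s≤s′

          many-walks : ∀ z → n ^ N ≤ N ^ N * W N x z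
          many-walks z = begin
            n ^ N                      ≡⟨ *-identityˡ _ ⟨
            1 * n ^ N                  ≡⟨ cong (λ b → 𝟙 b * n ^ N) (size-full (reach N) all z) ⟨
            𝟙 (reach N z) * n ^ N      ≤⟨ reach⇒many-walks N z ⟩
            N ^ N * W N x z            ∎
            where
            open ≤-Reasoning
            N≢0 : NonZero N
            N≢0 = >-nonZero (≤-trans (>-nonZero⁻¹ (2 * D) {{m*n≢0 2 D}}) 2D≤N)
            all : n ≤ size (reach N)
            -- After `N` steps the growth alternative reads `N * n ≤ N * s`, so both alternatives
            -- say that the set is full.
            all = [_,_]′ (*-cancelˡ-≤ N {{N≢0}}) id (proj₂ (reach-large N))

        -- Entries of one column differ by at most `(p / q) * d ^ j`. Their mean is `d ^ suc j / n`,
        -- which is at least `d ^ j / D`, so a small `p / q` gives a small relative error.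
        Oscillation : ℕ → ℕ → ℕ → Set
        Oscillation p q j = ∀ x x′ y → q * W j x y ≤ q * W j x′ y + p * d ^ j

        oscillation-zero : Oscillation 1 1 0
        oscillation-zero x x′ y = ≤-trans (≤-reflexive (*-identityˡ _))
            (≤-trans (𝟙≤1 (Graph.adjacent G x y)) (m≤n+m 1 (1 * W 0 x′ y)))

        -- Each entry of `W (suc j)` is a sum of `d` entries of `W j` from the same column, and
        -- averaging cannot increase the spread. This passes from the multiples of `suc N` to all
        -- larger lengths.
        oscillation-suc : ∀ {p q j} → Oscillation p q j → Oscillation p q (suc j)
        oscillation-suc {p} {q} {j} osc x x′ y = ≤-trans
          (∑-weighted-oscillation (A x) (A x′) (λ w → W j (σ w) y) {d} {q} {p * d ^ j} (regular x)
              (regular x′) (λ z z′ → osc (σ z) (σ z′) y))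
          (≤-reflexive (cong (q * W (suc j) x′ y +_) (shape d p (d ^ j))))
          where
          shape : ∀ d p e → d * (p * e) ≡ p * (d * e)
          shape = solve-∀

        -- Doeblin's argument: the part n ^ N common to all rows of suc c * W N does
        -- not contribute to the oscillation.
        oscillation-contract : ∀ {N c p q j} → d ≤ n → (∀ x z → n ^ N ≤ suc c * W N x z) →
                               Oscillation p q j → Oscillation (c * p) (suc c * q) (suc (N + j))
        oscillation-contract {N} {c} {p} {q} {j} d≤n minor osc x x′ y = begin
          suc c * q * W (suc (N + j)) x y
            ≡⟨ expand x ⟩
          q * ∑[ z ∈ V ] (a x z * f z) + common
            ≤⟨ +-monoˡ-≤ common (∑-weighted-oscillation (a x) (a x′) f {R} {q} {p * d ^ j} refl
                (trans (total x′) (sym (total x))) (λ z z′ → osc (σ z) (σ z′) y)) ⟩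
          q * ∑[ z ∈ V ] (a x′ z * f z) + R * (p * d ^ j) + common
            ≡⟨ shape₁ (q * ∑[ z ∈ V ] (a x′ z * f z)) (R * (p * d ^ j)) common ⟩
          q * ∑[ z ∈ V ] (a x′ z * f z) + common + R * (p * d ^ j)
            ≤⟨ +-mono-≤ (≤-reflexive (sym (expand x′))) (*-monoˡ-≤ (p * d ^ j) R≤) ⟩
          suc c * q * W (suc (N + j)) x′ y + c * d ^ suc N * (p * d ^ j)
            ≡⟨ cong (suc c * q * W (suc (N + j)) x′ y +_)
                (trans (shape₂ c (d ^ suc N) p (d ^ j))
                (cong (c * p *_) (sym (^-distribˡ-+-* d (suc N) j)))) ⟩
          suc c * q * W (suc (N + j)) x′ y + c * p * d ^ suc (N + j) ∎
          where
          open ≤-Reasoning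
          a : Fin n → Fin n → ℕ
          a x z = suc c * W N x z ∸ n ^ N
          f : Fin n → ℕ
          f z = W j (σ z) y
          R common : ℕ
          R = ∑ V (a x)
          common = q * (n ^ N * ∑ V f)
          a-def : ∀ x z → suc c * W N x z ≡ a x z + n ^ N
          a-def x z = sym (m∸n+n≡m (minor x z))
          sum-a : ∀ x → ∑ V (a x) + n * n ^ N ≡ suc c * d ^ suc N
          sum-a x = begin-equality
            ∑ V (a x) + n * n ^ N                ≡⟨ cong (∑ V (a x) +_) (∑-V-const (n ^ N)) ⟨
            ∑ V (a x) + ∑[ z ∈ V ] (n ^ N)       ≡⟨ ∑-+ V (a x) _ ⟨
            ∑[ z ∈ V ] (a x z + n ^ N)           ≡⟨ ∑-cong V (a-def x) ⟨
            ∑[ z ∈ V ] (suc c * W N x z)         ≡⟨ ∑-*ˡ V (suc c) (W N x) ⟩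
            suc c * ∑ V (W N x)                  ≡⟨ cong (suc c *_) (W-row-sum regular N x) ⟩
            suc c * d ^ suc N                    ∎
          total : ∀ x → ∑ V (a x) ≡ suc c * d ^ suc N ∸ n * n ^ N
          total x = trans (sym (m+n∸n≡m _ (n * n ^ N))) (cong (_∸ n * n ^ N) (sum-a x))
          -- The removed mass `n * n ^ N` is at least `d ^ suc N`, which is one of the `suc c` equal
          -- shares of the row sum. Hence the contraction factor `c / suc c`.
          R≤ : R ≤ c * d ^ suc N
          R≤ = +-cancelʳ-≤ (d ^ suc N) _ _ (begin
            R + d ^ suc N                ≤⟨ +-monoʳ-≤ R (^-monoˡ-≤ (suc N) d≤n) ⟩
            R + n ^ suc N                ≡⟨ sum-a x ⟩
            suc c * d ^ suc N            ≡⟨ +-comm (d ^ suc N) _ ⟩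
            c * d ^ suc N + d ^ suc N    ∎)
          expand : ∀ x → suc c * q * W (suc (N + j)) x y ≡ q * ∑[ z ∈ V ] (a x z * f z) + common
          expand x = begin-equality
            suc c * q * W (suc (N + j)) x y
              ≡⟨ cong (suc c * q *_) (W-concat N j x y) ⟩
            suc c * q * ∑[ z ∈ V ] (W N x z * f z)
              ≡⟨ trans (cong (_* ∑[ z ∈ V ] (W N x z * f z)) (*-comm (suc c) q))
                  (trans (*-assoc q (suc c) _) (cong (q *_) (sym (∑-*ˡ V (suc c) _)))) ⟩
            q * ∑[ z ∈ V ] (suc c * (W N x z * f z))
              ≡⟨ cong (q *_) (∑-cong V λ z → trans (sym (*-assoc (suc c) (W N x z) (f z)))
                  (trans (cong (_* f z) (a-def x z)) (*-distribʳ-+ (f z) (a x z) (n ^ N)))) ⟩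
            q * ∑[ z ∈ V ] (a x z * f z + n ^ N * f z)
              ≡⟨ trans (cong (q *_) (trans (∑-+ V _ _)
                  (cong (∑[ z ∈ V ] (a x z * f z) +_) (∑-*ˡ V (n ^ N) f)))) (*-distribˡ-+ q _ _) ⟩
            q * ∑[ z ∈ V ] (a x z * f z) + common ∎
          shape₁ : ∀ a b c → a + b + c ≡ a + c + b
          shape₁ = solve-∀
          shape₂ : ∀ c e p h → c * e * (p * h) ≡ c * p * (e * h)
          shape₂ = solve-∀

        oscillation-iterate : ∀ {N c} → d ≤ n → (∀ x z → n ^ N ≤ suc c * W N x z) →
                              ∀ k → Oscillation (c ^ k) (suc c ^ k) (k * suc N)
        oscillation-iterate d≤n minor zero    = oscillation-zero
        oscillation-iterate {N} {c} d≤n minor (suc k) = oscillation-contract {N} {c} {c ^ k} {suc c ^ k}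
            {k * suc N} d≤n minor (oscillation-iterate {N} {c} d≤n minor k)

        module _ {D p q j : ℕ} (n≤Dd : n ≤ D * d) (osc : Oscillation p q j) where

          private
            error : n * (p * d ^ j) ≤ D * p * d ^ suc j
            error = ≤-trans (*-monoˡ-≤ _ n≤Dd) (≤-reflexive (shape D d p (d ^ j)))
              where
              shape : ∀ D d p e → D * d * (p * e) ≡ D * p * (d * e)
              shape = solve-∀

          -- The entry is compared with every other entry of its column; summing over `x′` replaces
          -- those by the known column sum, at the cost of `n` oscillation errors.
          W-upper : ∀ x y → q * (n * W j x y) ≤ (q + D * p) * d ^ suc j
          W-upper x y = begin
            q * (n * W j x y)                             ≡⟨ shape q n (W j x y) ⟩
            n * (q * W j x y)                             ≡⟨ ∑-V-const _ ⟨
            ∑[ x′ ∈ V ] (q * W j x y)                     ≤⟨ ∑-mono V (λ x′ → osc x x′ y) ⟩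
            ∑[ x′ ∈ V ] (q * W j x′ y + p * d ^ j)
                ≡⟨ trans (∑-+ V _ _) (cong₂ _+_ (∑-*ˡ V q _) (∑-V-const _)) ⟩
            q * ∑[ x′ ∈ V ] W j x′ y + n * (p * d ^ j)
                ≤⟨ +-mono-≤ (≤-reflexive (cong (q *_) (W-column-sum regular sym-A j y))) error ⟩
            q * d ^ suc j + D * p * d ^ suc j             ≡⟨ *-distribʳ-+ (d ^ suc j) q (D * p) ⟨
            (q + D * p) * d ^ suc j                       ∎
            where
            open ≤-Reasoning
            shape : ∀ q n w → q * (n * w) ≡ n * (q * w)
            shape = solve-∀

          W-lower : ∀ x y → q * d ^ suc j ≤ q * (n * W j x y) + D * p * d ^ suc j
          W-lower x y = begin
            q * d ^ suc j                                 ≡⟨ cong (q *_) (W-column-sum regular sym-A j y) ⟨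
            q * ∑[ x′ ∈ V ] W j x′ y                      ≡⟨ ∑-*ˡ V q _ ⟨
            ∑[ x′ ∈ V ] (q * W j x′ y)                    ≤⟨ ∑-mono V (λ x′ → osc x′ x y) ⟩
            ∑[ x′ ∈ V ] (q * W j x y + p * d ^ j)         ≡⟨ ∑-V-const _ ⟩
            n * (q * W j x y + p * d ^ j)                 ≡⟨ shape n q (W j x y) (p * d ^ j) ⟩
            q * (n * W j x y) + n * (p * d ^ j)           ≤⟨ +-monoʳ-≤ (q * (n * W j x y)) error ⟩
            q * (n * W j x y) + D * p * d ^ suc j         ∎
            where
            open ≤-Reasoning
            shape : ∀ n q w e → n * (q * w + e) ≡ q * (n * w) + n * e
            shape = solve-∀

  -- Explicit walk length and accuracy of the walk counts

  bernoulli : ∀ c k → (c + k) * c ^ k ≤ c * suc c ^ k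
  bernoulli c zero    = ≤-reflexive (cong (_* 1) (+-identityʳ c))
  bernoulli c (suc k) = begin
    (c + suc k) * (c * c ^ k)
        ≤⟨ ≤-trans (m≤m+n _ (k * c ^ k)) (≤-reflexive (shape c k (c ^ k))) ⟩
    suc c * ((c + k) * c ^ k)             ≤⟨ *-monoʳ-≤ (suc c) (bernoulli c k) ⟩
    suc c * (c * suc c ^ k)               ≡⟨ shape₂ c (suc c ^ k) ⟩
    c * (suc c * suc c ^ k)               ∎
    where
    open ≤-Reasoning
    shape : ∀ c k p → (c + suc k) * (c * p) + k * p ≡ suc c * ((c + k) * p)
    shape = solve-∀
    shape₂ : ∀ c p → suc c * (c * p) ≡ c * (suc c * p)
    shape₂ = solve-∀

  -- For `k = c * M` Bernoulli's bound `(1 + 1 / c) ^ k ≥ 1 + k / c` exceeds `M`, so that many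
  -- contractions by `c / suc c` reduce the oscillation to at most `1 / M`.
  geometric-decay : ∀ c M .{{_ : NonZero c}} → M * c ^ (c * M) ≤ suc c ^ (c * M)
  geometric-decay c M = *-cancelˡ-≤ c (begin
    c * (M * c ^ (c * M))          ≡⟨ *-assoc c M _ ⟨
    c * M * c ^ (c * M)            ≤⟨ *-monoˡ-≤ _ (m≤n+m (c * M) c) ⟩
    (c + c * M) * c ^ (c * M)      ≤⟨ bernoulli c (c * M) ⟩
    c * suc c ^ (c * M)            ∎)
    where open ≤-Reasoning

  -- The number `N ^ N * (L * D)` of contractions, each of which costs `suc N` pairs, brings the
  -- oscillation down to `1 / (L * D)`. The factor `D` pays for the passage to relative errors. No
  -- dependence on `n` enters.
  burnIn : ℕ → ℕ → ℕ → ℕ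
  burnIn D N L = N ^ N * (L * D) * suc N

  module Estimates {n : ℕ} (D N L : ℕ) .{{_ : NonZero D}} (2D≤N : 2 * D ≤ N) where
    open Graphs n
    open Mixing n

    module _ (G : Graph n) {d} (regular : IntRegular d G) (n≤Dd : n ≤ D * d) (d≤n : d ≤ n)
             (robust : IntRobust N (2 * D) G)
             (σ : Fin n → Fin n) (σσ : ∀ x → σ (σ x) ≡ x) where
      open Walks G σ

      private
        sym-A : ∀ x y → A x y ≡ A y x
        sym-A x y = cong 𝟙 (Graph.symmetric G x y)

        c k p q : ℕ
        c = N ^ N
        k = c * (L * D)
        p = c ^ k
        q = suc c ^ k

        instance
          2D≢0 : NonZero (2 * D)
          2D≢0 = m*n≢0 2 D
          N≢0 : NonZero N
          N≢0 = >-nonZero (≤-trans (>-nonZero⁻¹ (2 * D)) 2D≤N)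
          c≢0 : NonZero c
          c≢0 = m^n≢0 N N
          q≢0 : NonZero q
          q≢0 = m^n≢0 (suc c) k

        small : L * (D * p) ≤ q
        small = ≤-trans (≤-reflexive (sym (*-assoc L D p))) (geometric-decay c (L * D))

        minor : ∀ x z → n ^ N ≤ suc c * W N x z
        minor x z = ≤-trans (Spread.many-walks G σ σσ sym-A regular D N robust n≤Dd 2D≤N x z)
            (*-monoˡ-≤ (W N x z) (n≤1+n c))

        osc : ∀ i → Oscillation G σ σσ sym-A regular p q (i + burnIn D N L)
        osc zero    = oscillation-iterate G σ σσ sym-A regular {N} {c} d≤n minor k
        osc (suc i) = oscillation-suc G σ σσ sym-A regular {p} {q} {i + burnIn D N L} (osc i)

        osc-≥ : ∀ {j} → burnIn D N L ≤ j → Oscillation G σ σσ sym-A regular p q j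
        osc-≥ {j} b≤j = subst (Oscillation G σ σσ sym-A regular p q) (m∸n+n≡m b≤j) (osc (j ∸ burnIn D N L))

      module _ {j : ℕ} (burnt : burnIn D N L ≤ j) where

        W-mixed-upper : ∀ x y → L * (n * W j x y) ≤ suc L * d ^ suc j
        W-mixed-upper x y = *-cancelˡ-≤ q (begin
          q * (L * (n * W j x y))                ≡⟨ swap q L _ ⟩
          L * (q * (n * W j x y))
              ≤⟨ *-monoʳ-≤ L (W-upper G σ σσ sym-A regular {D} {p} {q} {j} n≤Dd (osc-≥ burnt) x y) ⟩
          L * ((q + D * p) * e)                  ≡⟨ shape L q (D * p) e ⟩
          (L * q + L * (D * p)) * e              ≤⟨ *-monoˡ-≤ e (+-monoʳ-≤ (L * q) small) ⟩
          (L * q + q) * e                        ≡⟨ shape₂ L q e ⟩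
          q * (suc L * e)                        ∎)
          where
          open ≤-Reasoning
          e : ℕ
          e = d ^ suc j
          swap : ∀ a b c → a * (b * c) ≡ b * (a * c)
          swap = solve-∀
          shape : ∀ L q r e → L * ((q + r) * e) ≡ (L * q + L * r) * e
          shape = solve-∀
          shape₂ : ∀ L q e → (L * q + q) * e ≡ q * (suc L * e)
          shape₂ = solve-∀

        W-mixed-lower : ∀ x y → L * d ^ suc j ≤ L * (n * W j x y) + d ^ suc j
        W-mixed-lower x y = *-cancelˡ-≤ q (begin
          q * (L * e)                            ≡⟨ swap q L e ⟩
          L * (q * e)
              ≤⟨ *-monoʳ-≤ L (W-lower G σ σσ sym-A regular {D} {p} {q} {j} n≤Dd (osc-≥ burnt) x y) ⟩
          L * (q * (n * W j x y) + D * p * e)    ≡⟨ shape L q (n * W j x y) D p e ⟩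
          q * (L * (n * W j x y)) + L * (D * p) * e
              ≤⟨ +-monoʳ-≤ (q * (L * (n * W j x y))) (*-monoˡ-≤ e small) ⟩
          q * (L * (n * W j x y)) + q * e        ≡⟨ *-distribˡ-+ q _ e ⟨
          q * (L * (n * W j x y) + e)            ∎)
          where
          open ≤-Reasoning
          e : ℕ
          e = d ^ suc j
          swap : ∀ a b c → a * (b * c) ≡ b * (a * c)
          swap = solve-∀
          shape : ∀ L q r D p e → L * (q * r + D * p * e) ≡ q * (L * r) + L * (D * p) * e
          shape = solve-∀

        module _ (F : List (Fin n)) where

          P-upper : ∀ x y → L * (n * P j F x y) ≤ suc L * d ^ suc j
          P-upper x y = ≤-trans (*-monoʳ-≤ L (*-monoʳ-≤ n (P≤W j F x y))) (W-mixed-upper x y)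

          -- One `d ^ suc j` of the error comes from mixing, the other from walks that repeat a
          -- vertex or meet `F`. The latter form a fraction of order `B / d`, and the assumed size
          -- of `n` makes `D * (L * B) ≤ d`.
          P-lower : .{{_ : NonZero d}} → D * (D * (L * (j * (length F + 2 * j)))) ≤ n →
                    ∀ x y → L * d ^ suc j ≤ L * (n * P j F x y) + 2 * d ^ suc j
          P-lower large x y = *-cancelˡ-≤ d (begin
            d * (L * e)
              ≤⟨ *-monoʳ-≤ d (W-mixed-lower x y) ⟩
            d * (L * (n * W j x y) + e)
              ≡⟨ shape₁ d L n (W j x y) e ⟩
            L * n * (d * W j x y) + d * e
              ≤⟨ +-monoˡ-≤ (d * e) (*-monoʳ-≤ (L * n) (W≤P+error regular j F x y)) ⟩
            L * n * (d * P j F x y + B * d ^ j) + d * e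
              ≡⟨ shape₂ L n d (P j F x y) B (d ^ j) e ⟩
            d * (L * (n * P j F x y)) + L * B * n * d ^ j + d * e
              ≤⟨ +-monoˡ-≤ (d * e) (+-monoʳ-≤ (d * (L * (n * P j F x y))) error) ⟩
            d * (L * (n * P j F x y)) + d * e + d * e
              ≡⟨ shape₃ d (L * (n * P j F x y)) e ⟩
            d * (L * (n * P j F x y) + 2 * e) ∎)
            where
            open ≤-Reasoning
            e B : ℕ
            e = d ^ suc j
            B = j * (length F + 2 * j)
            DLB≤d : D * (L * B) ≤ d
            DLB≤d = *-cancelˡ-≤ D (≤-trans large n≤Dd)
            error : L * B * n * d ^ j ≤ d * e
            error = begin
              L * B * n * d ^ j               ≤⟨ *-monoˡ-≤ (d ^ j) (*-monoʳ-≤ (L * B) n≤Dd) ⟩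
              L * B * (D * d) * d ^ j         ≡⟨ shape₄ L B D d (d ^ j) ⟩
              D * (L * B) * (d * d ^ j)       ≤⟨ *-monoˡ-≤ e DLB≤d ⟩
              d * e                           ∎
              where
              shape₄ : ∀ L B D d f → L * B * (D * d) * f ≡ D * (L * B) * (d * f)
              shape₄ = solve-∀
            shape₁ : ∀ d L n w e → d * (L * (n * w) + e) ≡ L * n * (d * w) + d * e
            shape₁ = solve-∀
            shape₂ : ∀ L n d p B f e → L * n * (d * p + B * f) + d * e ≡ d * (L * (n * p)) + L * B * n * f +
                d * e
            shape₂ = solve-∀
            shape₃ : ∀ d a e → d * a + d * e + d * e ≡ d * (a + 2 * e)
            shape₃ = solve-∀

  -- Matchings as involutions, and switching

  -- Involutions are stored as vectors so that pointwise agreement is equality and each of them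
  -- occurs exactly once in a finite list.
  vectors : ∀ {n} k → List (Vec (Fin n) k)
  vectors         zero    = [] ∷ []
  vectors {n = n} (suc k) = cartesianProductWith _∷_ (allFin n) (vectors k)

  vectors-unique : ∀ {n} k → Unique (vectors {n} k)
  vectors-unique         zero    = [] ∷ []
  vectors-unique {n = n} (suc k) = cartesianProductWith⁺ _∷_ ∷-injective (allFin⁺ n) (vectors-unique k)

  ∈-vectors : ∀ {n k} (v : Vec (Fin n) k) → v ∈ vectors k
  ∈-vectors []      = here refl
  ∈-vectors (x ∷ v) = ∈-cartesianProductWith⁺ _∷_ (∈-allFin x) (∈-vectors v)

  lookup-extensional : ∀ {a} {A : Set a} {n} {u v : Vec A n} → (∀ i → lookup u i ≡ lookup v i) → u ≡ v
  lookup-extensional {u = u} {v} h = trans (sym (tabulate∘lookup u))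
      (trans (tabulate-cong h) (tabulate∘lookup v))

  outside : ∀ {n} → Fin n → List (Fin n) → ℕ
  outside w F = [ ¬? (w ∈ꟳ? F) ]

  outside-∉ : ∀ {n} {w : Fin n} {F} → w ∉ F → outside w F ≡ 1
  outside-∉ {w = w} {F} = []-true (¬? (w ∈ꟳ? F))

  outside-∈ : ∀ {n} {w : Fin n} {F} → w ∈ F → outside w F ≡ 0
  outside-∈ {w = w} {F} w∈ = []-false (¬? (w ∈ꟳ? F)) (λ w∉ → w∉ w∈)

  outside-positive : ∀ {n} {w : Fin n} {F} → 0 < outside w F → w ∉ F
  outside-positive pos w∈ = <⇒≱ pos (≤-reflexive (outside-∈ w∈))

  outside-cong : ∀ {n} {w : Fin n} {F F′} → F ⊆ F′ → F′ ⊆ F → outside w F ≡ outside w F′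
  outside-cong {w = w} {F} {F′} i j = []-cong (¬? (w ∈ꟳ? F)) (¬? (w ∈ꟳ? F′)) (λ w∉ → w∉ ∘ j) (λ w∉ → w∉ ∘ i)

  outside-guard : ∀ {n} (w : Fin n) F {a b} → (w ∉ F → a ≡ b) → outside w F * a ≡ outside w F * b
  outside-guard w F h with w ∈ꟳ? F
  ... | yes _ = refl
  ... | no w∉ = cong (1 *_) (h w∉)

  outside-∷ : ∀ {n} (w x : Fin n) F → outside w (x ∷ F) ≡ outside w (x ∷ []) * outside w F
  outside-∷ w x F = deMorgan (does (w ≟ꟳ x)) (does (w ∈ꟳ? F))
    where
    deMorgan : ∀ b c → 𝟙 (not (b ∨ c)) ≡ 𝟙 (not (b ∨ false)) * 𝟙 (not c)
    deMorgan true  c = refl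
    deMorgan false c = sym (*-identityˡ _)

  ⊆-∷-cong : ∀ {n} (b : Fin n) {F F′} → F ⊆ F′ → b ∷ F ⊆ b ∷ F′
  ⊆-∷-cong b i (here refl) = here refl
  ⊆-∷-cong b i (there v∈)  = there (i v∈)

  -- Either side tests that `w` and `b` are distinct and both outside `F`; only the order of
  -- choosing them differs.
  outside-swap : ∀ {n} (w b : Fin n) F → outside w F * outside b (w ∷ F) ≡ outside b F * outside w (b ∷ F)
  outside-swap w b F = begin
    outside w F * outside b (w ∷ F)                       ≡⟨ cong (outside w F *_) (outside-∷ b w F) ⟩
    outside w F * (outside b (w ∷ []) * outside b F)
        ≡⟨ cong (λ t → outside w F * (t * outside b F)) flip ⟩
    outside w F * (outside w (b ∷ []) * outside b F)
        ≡⟨ shape (outside w F) (outside w (b ∷ [])) (outside b F) ⟩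
    outside b F * (outside w (b ∷ []) * outside w F)      ≡⟨ cong (outside b F *_) (outside-∷ w b F) ⟨
    outside b F * outside w (b ∷ F)                       ∎
    where
    open ≡-Reasoning
    flip : outside b (w ∷ []) ≡ outside w (b ∷ [])
    flip = []-cong (¬? (b ∈ꟳ? (w ∷ []))) (¬? (w ∈ꟳ? (b ∷ [])))
      (λ b∉ → λ { (here refl) → b∉ (here refl) }) (λ w∉ → λ { (here refl) → w∉ (here refl) })
    shape : ∀ a b c → a * (b * c) ≡ c * (b * a)
    shape = solve-∀

  module _ {n : ℕ} (a : Fin n) (a′ : Fin n) (b : Fin n) (b′ : Fin n) (s : Fin n → Fin n) where

    override : Fin n → Fin n
    override v with v ≟ꟳ a | v ≟ꟳ b
    ... | yes _ | _     = a′
    ... | no _  | yes _ = b′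
    ... | no _  | no _  = s v

    override-first : override a ≡ a′
    override-first with a ≟ꟳ a
    ... | yes _  = refl
    ... | no a≢a = ⊥-elim (a≢a refl)

    override-second : a ≢ b → override b ≡ b′
    override-second a≢b with b ≟ꟳ a | b ≟ꟳ b
    ... | yes refl | _      = ⊥-elim (a≢b refl)
    ... | no _     | yes _  = refl
    ... | no _     | no b≢b = ⊥-elim (b≢b refl)

    override-other : ∀ {v} → v ≢ a → v ≢ b → override v ≡ s v
    override-other {v} v≢a v≢b with v ≟ꟳ a | v ≟ꟳ b
    ... | yes eq | _      = ⊥-elim (v≢a eq)
    ... | no _   | yes eq = ⊥-elim (v≢b eq)
    ... | no _   | no _   = refl

  module Matchings {n : ℕ} (G : Graph n) where
    open Graphs n
    open Graph G using (adjacent; symmetric; irreflexive)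

    private
      A : Fin n → Fin n → ℕ
      A = adj G

    adjacent⇒≢ : ∀ {x y} → adjacent x y ≡ true → x ≢ y
    adjacent⇒≢ {x} eq refl with trans (sym eq) (irreflexive x)
    ... | ()

    Matches : List (Fin n) → (Fin n → Fin n) → Set
    Matches F s = ∀ v → s (s v) ≡ v × (v ∈ F → s v ≡ v) × (v ∉ F → adjacent v (s v) ≡ true)

    -- A perfect matching of G − F, encoded as the involution that exchanges the
    -- ends of its edges and fixes F.
    IsMatching : List (Fin n) → Vec (Fin n) n → Set
    IsMatching F σ = Matches F (lookup σ)

    isMatching? : ∀ F → Decidable (IsMatching F)
    isMatching? F σ = all? λ v → (lookup σ (lookup σ v) ≟ꟳ v) ×-dec ((v ∈ꟳ? F) →-dec (lookup σ v ≟ꟳ v))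
                                   ×-dec (¬? (v ∈ꟳ? F) →-dec (adjacent v (lookup σ v) ≟ᵇ true))

    𝓜 : List (Fin n) → List (Vec (Fin n) n)
    𝓜 F = filter (isMatching? F) (vectors n)

    𝓜-unique : ∀ F → Unique (𝓜 F)
    𝓜-unique F = filter⁺ (isMatching? F) (vectors-unique n)

    ∈-𝓜⁻ : ∀ {F σ} → σ ∈ 𝓜 F → IsMatching F σ
    ∈-𝓜⁻ {F} σ∈ = proj₂ (∈-filter⁻ (isMatching? F) {xs = vectors n} σ∈)

    ∈-𝓜⁺ : ∀ {F σ} → IsMatching F σ → σ ∈ 𝓜 F
    ∈-𝓜⁺ {F} {σ} m = ∈-filter⁺ (isMatching? F) (∈-vectors σ) m

    tabulate-matches : ∀ {F s} → Matches F s → IsMatching F (tabulate s)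
    tabulate-matches {F} {s} m v =
        trans (trans (lookup∘tabulate s _) (cong s (lookup∘tabulate s v))) (proj₁ (m v))
      , (λ v∈ → trans (lookup∘tabulate s v) (proj₁ (proj₂ (m v)) v∈))
      , (λ v∉ → trans (cong (adjacent v) (lookup∘tabulate s v)) (proj₂ (proj₂ (m v)) v∉))

    H : List (Fin n) → ℕ
    H F = length (𝓜 F)

    H-cong : ∀ {F F′} → F ⊆ F′ → F′ ⊆ F → H F ≡ H F′
    H-cong {F} {F′} i j = cong length (filter-≐ (isMatching? F) (isMatching? F′)
      ((λ {σ} m v → proj₁ (m v) , proj₁ (proj₂ (m v)) ∘ j , λ v∉ → proj₂ (proj₂ (m v)) (v∉ ∘ i)) ,
       (λ {σ} m v → proj₁ (m v) , proj₁ (proj₂ (m v)) ∘ i , λ v∉ → proj₂ (proj₂ (m v)) (v∉ ∘ j)))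
           (vectors n))

    AgreeOutside : List (Fin n) → Vec (Fin n) n → Vec (Fin n) n → Set
    AgreeOutside F σ τ = ∀ v → v ∉ F → lookup σ v ≡ lookup τ v

    module _ {F : List (Fin n)} {w z : Fin n} (w∉F : w ∉ F) where

      private
        F⁺ : List (Fin n)
        F⁺ = z ∷ w ∷ F

        unpaired : ∀ {σ} → σ ∈ 𝓜 F → lookup σ w ≡ z → A w z ≡ 1 × outside z (w ∷ F) ≡ 1
        unpaired {σ} σ∈ eq = cong 𝟙 Awz , outside-∉ {F = w ∷ F} z∉
          where
          m = ∈-𝓜⁻ σ∈
          Awz : adjacent w z ≡ true
          Awz = trans (cong (adjacent w) (sym eq)) (proj₂ (proj₂ (m w)) w∉F)
          z∉ : z ∉ w ∷ F
          z∉ (here refl) = adjacent⇒≢ Awz refl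
          z∉ (there z∈)  = w∉F (subst (_∈ F)
              (trans (sym (proj₁ (proj₂ (m z)) z∈)) (trans (cong (lookup σ) (sym eq)) (proj₁ (m w)))) z∈)

        paired? : Decidable (λ (σ : Vec (Fin n) n) → lookup σ w ≡ z)
        paired? σ = lookup σ w ≟ꟳ z

        split join : (Fin n → Fin n) → Fin n → Fin n
        split = override w w z z
        join  = override w z z w

        module _ (Awz : adjacent w z ≡ true) (z∉F : z ∉ F) where

          w≢z : w ≢ z
          w≢z = adjacent⇒≢ Awz

          split-matches : ∀ {s} → Matches F s → s w ≡ z → Matches F⁺ (split s)
          split-matches {s} m sw v with v ≟ꟳ w | v ≟ꟳ z
          ... | yes refl | _        = override-first w w z z s , (λ _ → refl) ,
              (λ v∉ → ⊥-elim (v∉ (there (here refl))))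
          ... | no _     | yes refl = override-second w w z z s w≢z , (λ _ → refl) ,
              (λ v∉ → ⊥-elim (v∉ (here refl)))
          ... | no v≢w   | no v≢z   =
              trans (override-other w w z z s sv≢w sv≢z) (proj₁ (m v))
            , (λ { (here eq) → ⊥-elim (v≢z eq) ; (there (here eq)) → ⊥-elim (v≢w eq) ; (there (there v∈)) →
                proj₁ (proj₂ (m v)) v∈ })
            , (λ v∉ → proj₂ (proj₂ (m v)) (v∉ ∘ there ∘ there))
            where
            sv≢w : s v ≢ w
            sv≢w eq = v≢z (trans (sym (proj₁ (m v))) (trans (cong s eq) sw))
            sv≢z : s v ≢ z
            sv≢z eq = v≢w (trans (sym (proj₁ (m v))) (trans (cong s (trans eq (sym sw))) (proj₁ (m w))))

          module _ {t : Fin n → Fin n} (m : Matches F⁺ t) where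

            private
              tw : t w ≡ w
              tw = proj₁ (proj₂ (m w)) (there (here refl))
              tz : t z ≡ z
              tz = proj₁ (proj₂ (m z)) (here refl)

            join-matches : Matches F (join t)
            join-matches v with v ≟ꟳ w | v ≟ꟳ z
            ... | yes refl | _        = override-second w z z w t w≢z , (λ w∈ → ⊥-elim (w∉F w∈)) ,
                (λ _ → Awz)
            ... | no _     | yes refl = override-first w z z w t , (λ z∈ → ⊥-elim (z∉F z∈)) ,
                (λ _ → trans (symmetric z w) Awz)
            ... | no v≢w   | no v≢z   =
                trans (override-other w z z w t
                    (λ eq → v≢w (trans (sym (proj₁ (m v))) (trans (cong t eq) tw)))
                                                (λ eq → v≢z (trans (sym (proj₁ (m v)))
                                                    (trans (cong t eq) tz)))) (proj₁ (m v))
              , (λ v∈ → proj₁ (proj₂ (m v)) (there (there v∈)))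
              , (λ v∉ → proj₂ (proj₂ (m v)) λ { (here eq) → v≢z eq ; (there (here eq)) → v≢w eq ;
                  (there (there v∈)) → v∉ v∈ })

            split-join : ∀ {u} → (∀ v → u v ≡ join t v) → ∀ v → split u v ≡ t v
            split-join {u} u≗ v with v ≟ꟳ w | v ≟ꟳ z
            ... | yes refl | _        = sym tw
            ... | no _     | yes refl = sym tz
            ... | no v≢w   | no v≢z   = trans (u≗ v) (override-other w z z w t v≢w v≢z)

          join-split : ∀ {s u} → Matches F s → s w ≡ z → (∀ v → u v ≡ split s v) → ∀ v → join u v ≡ s v
          join-split {s} m sw u≗ v with v ≟ꟳ w | v ≟ꟳ z
          ... | yes refl | _        = sym sw
          ... | no _     | yes refl = sym (trans (cong s (sym sw)) (proj₁ (m w)))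
          ... | no v≢w   | no v≢z   = trans (u≗ v) (override-other w w z z s v≢w v≢z)

          -- Deleting the pair `{w, z}` and restoring it are inverse bijections. They change the
          -- involution only at `w` and `z`, where `g` does not look.
          ∑-paired : ∀ g → (∀ σ τ → AgreeOutside F⁺ σ τ → g σ ≡ g τ) →
                     ∑ (filter paired? (𝓜 F)) g ≡ ∑ (𝓜 F⁺) g
          ∑-paired g local = ∑-bijection h k g g (filter⁺ paired? (𝓜-unique F)) (𝓜-unique F⁺) to from
            where
            h k : Vec (Fin n) n → Vec (Fin n) n
            h σ = tabulate (split (lookup σ))
            k τ = tabulate (join (lookup τ))
            to : ∀ {σ} → σ ∈ filter paired? (𝓜 F) → h σ ∈ 𝓜 F⁺ × k (h σ) ≡ σ × g σ ≡ g (h σ)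
            to {σ} σ∈ with ∈-filter⁻ paired? {xs = 𝓜 F} σ∈
            ... | σ∈𝓜 , sw = ∈-𝓜⁺ (tabulate-matches (split-matches m sw))
              , lookup-extensional (λ v → trans (lookup∘tabulate _ v)
                  (join-split m sw (lookup∘tabulate _) v))
              , local σ (h σ) (λ v v∉ → sym (trans (lookup∘tabulate _ v)
                  (override-other w w z z (lookup σ) (v∉ ∘ there ∘ here) (v∉ ∘ here))))
              where m = ∈-𝓜⁻ σ∈𝓜
            from : ∀ {τ} → τ ∈ 𝓜 F⁺ → k τ ∈ filter paired? (𝓜 F) × h (k τ) ≡ τ
            from {τ} τ∈ = ∈-filter⁺ paired? (∈-𝓜⁺ (tabulate-matches (join-matches m)))
                (trans (lookup∘tabulate _ w) (override-first w z z w (lookup τ)))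
              , lookup-extensional (λ v → trans (lookup∘tabulate _ v) (split-join m (lookup∘tabulate _) v))
              where m = ∈-𝓜⁻ τ∈

      ∑-matched-to : ∀ g → (∀ σ τ → AgreeOutside (z ∷ w ∷ F) σ τ → g σ ≡ g τ) →
                     ∑[ σ ∈ 𝓜 F ] ([ lookup σ w ≟ꟳ z ] * g σ) ≡ A w z *
                         (outside z (w ∷ F) * ∑ (𝓜 (z ∷ w ∷ F)) g)
      ∑-matched-to g local with adjacent w z in Awz | z ∈ꟳ? (w ∷ F)
      ... | true  | no z∉  = begin
        ∑[ σ ∈ 𝓜 F ] ([ paired? σ ] * g σ)   ≡⟨ ∑-filter paired? (𝓜 F) g ⟨
        ∑ (filter paired? (𝓜 F)) g           ≡⟨ ∑-paired Awz (z∉ ∘ there) g local ⟩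
        S                                    ≡⟨ *-identityˡ S ⟨
        1 * S                                ≡⟨ cong (_* S) (outside-∉ z∉) ⟨
        outside z (w ∷ F) * S                ≡⟨ *-identityˡ _ ⟨
        1 * (outside z (w ∷ F) * S)          ∎
        where
        open ≡-Reasoning
        S : ℕ
        S = ∑ (𝓜 (z ∷ w ∷ F)) g
      ... | false | _ = trans (∑-cong-∈ (𝓜 F) vanish) (∑-zero (𝓜 F))
        where
        vanish : ∀ σ → σ ∈ 𝓜 F → [ paired? σ ] * g σ ≡ 0
        vanish σ σ∈ = cong (_* g σ) ([]-false (paired? σ) λ eq → 0≢1+n
            (trans (cong 𝟙 (sym Awz)) (proj₁ (unpaired σ∈ eq))))
      ... | true  | yes z∈ = trans (trans (∑-cong-∈ (𝓜 F) vanish) (∑-zero (𝓜 F)))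
                                   (cong (λ o → 1 * (o * ∑ (𝓜 (z ∷ w ∷ F)) g)) (sym (outside-∈ z∈)))
        where
        vanish : ∀ σ → σ ∈ 𝓜 F → [ paired? σ ] * g σ ≡ 0
        vanish σ σ∈ = cong (_* g σ) ([]-false (paired? σ) λ eq → 0≢1+n
            (trans (sym (outside-∈ z∈)) (proj₂ (unpaired σ∈ eq))))

    -- Matchings are grouped by the partner of `w`, and each group is in bijection with the
    -- matchings of what remains. Every application trades one pair of a matching for an explicit
    -- edge `w z`, which is how matchings dissolve into paths.
    ∑-over-partner : ∀ {F w} → w ∉ F → (Φ : Fin n → Vec (Fin n) n → ℕ) →
                     (∀ z σ τ → AgreeOutside (z ∷ w ∷ F) σ τ → Φ z σ ≡ Φ z τ) →
                     ∑[ σ ∈ 𝓜 F ] Φ (lookup σ w) σ ≡ ∑[ z ∈ V ]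
                         (A w z * (outside z (w ∷ F) * ∑ (𝓜 (z ∷ w ∷ F)) (Φ z)))
    ∑-over-partner {F} {w} w∉F Φ local = begin
      ∑[ σ ∈ 𝓜 F ] Φ (lookup σ w) σ
        ≡⟨ ∑-cong (𝓜 F) (λ σ → ∑-delta-V (lookup σ w) (λ z → Φ z σ)) ⟨
      ∑[ σ ∈ 𝓜 F ] ∑[ z ∈ V ] ([ lookup σ w ≟ꟳ z ] * Φ z σ)
        ≡⟨ ∑-swap (𝓜 F) V _ ⟩
      ∑[ z ∈ V ] ∑[ σ ∈ 𝓜 F ] ([ lookup σ w ≟ꟳ z ] * Φ z σ)
        ≡⟨ ∑-cong V (λ z → ∑-matched-to w∉F (Φ z) (local z)) ⟩
      ∑[ z ∈ V ] (A w z * (outside z (w ∷ F) * ∑ (𝓜 (z ∷ w ∷ F)) (Φ z))) ∎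
      where open ≡-Reasoning

    Pᵛ : Vec (Fin n) n → ℕ → List (Fin n) → Fin n → Fin n → ℕ
    Pᵛ σ = Walks.P G (lookup σ)

    -- The involution is consulted only at vertices that have passed the test against `F`, and `F`
    -- only grows. A matching may therefore be altered on `F` without affecting the count.
    P-local : ∀ j {F} σ τ → AgreeOutside F σ τ → ∀ x y → Pᵛ σ j F x y ≡ Pᵛ τ j F x y
    P-local zero    σ τ agree x y = refl
    P-local (suc j) {F} σ τ agree x y = ∑-cong V λ w → cong (A x w *_) (term w)
      where
      term : ∀ w → outside w F * Pᵛ σ j (lookup σ w ∷ w ∷ F) (lookup σ w) y ≡
                   outside w F * Pᵛ τ j (lookup τ w ∷ w ∷ F) (lookup τ w) y
      term w = outside-guard w F λ w∉ → trans (cong (λ z → Pᵛ σ j (z ∷ w ∷ F) z y) (agree w w∉))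
          (P-local j σ τ (λ v v∉ → agree v (v∉ ∘ there ∘ there)) _ y)

    -- Pairs of a path of G − F with k inner vertices from x to y and a perfect
    -- matching of what the path leaves of G − F.
    R : ℕ → List (Fin n) → Fin n → Fin n → ℕ
    R zero    F x y = A x y * H F
    R (suc k) F x y = ∑[ w ∈ V ] (A x w * (outside w F * R k (w ∷ F) w y))

    R-cong : ∀ k {F F′} → F ⊆ F′ → F′ ⊆ F → ∀ x y → R k F x y ≡ R k F′ x y
    R-cong zero    i j x y = cong (A x y *_) (H-cong i j)
    R-cong (suc k) {F} {F′} i j x y = ∑-cong V λ w → cong (A x w *_)
      (cong₂ _*_ (outside-cong i j) (R-cong k (⊆-∷-cong w i) (⊆-∷-cong w j) w y))

    -- `R` is defined by peeling vertices off at `x`, but revealing the partner of the last vertex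
    -- fixes the neighbour of `y`. Choosing that neighbour first is harmless because the matching
    -- counted by `H` sees only the set of used vertices.
    R-expand-end : ∀ k F x y → R (suc k) F x y ≡ ∑[ b ∈ V ] (A b y * (outside b F * R k (b ∷ F) x b))
    R-expand-end zero    F x y = ∑-cong V λ w → shape (A x w) (outside w F) (A w y) (H (w ∷ F))
      where
      shape : ∀ a o b h → a * (o * (b * h)) ≡ b * (o * (a * h))
      shape = solve-∀
    R-expand-end (suc k) F x y = begin
      ∑[ w ∈ V ] (A x w * (outside w F * R (suc k) (w ∷ F) w y))
        ≡⟨ ∑-cong V (λ w → trans (sym (*-assoc (A x w) _ _))
            (trans (cong (A x w * outside w F *_) (R-expand-end k (w ∷ F) w y))
            (sym (∑-*ˡ V (A x w * outside w F) _)))) ⟩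
      ∑[ w ∈ V ] ∑[ b ∈ V ] (A x w * outside w F * (A b y * (outside b (w ∷ F) * R k (b ∷ w ∷ F) w b)))
        ≡⟨ ∑-swap V V _ ⟩
      ∑[ b ∈ V ] ∑[ w ∈ V ] (A x w * outside w F * (A b y * (outside b (w ∷ F) * R k (b ∷ w ∷ F) w b)))
        ≡⟨ ∑-cong V (λ b → trans (∑-cong V (λ w → term b w))
            (trans (∑-*ˡ V (A b y * outside b F) _) (*-assoc (A b y) (outside b F) _))) ⟩
      ∑[ b ∈ V ] (A b y * (outside b F * ∑[ w ∈ V ] (A x w * (outside w (b ∷ F) * R k (w ∷ b ∷ F) w b)))) ∎
      where
      open ≡-Reasoning
      shape₁ : ∀ a o b o′ r → a * o * (b * (o′ * r)) ≡ a * b * (o * o′) * r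
      shape₁ = solve-∀
      shape₂ : ∀ a b o o′ r → a * b * (o * o′) * r ≡ b * o * (a * (o′ * r))
      shape₂ = solve-∀
      exchange : ∀ {b w} → b ∷ w ∷ F ⊆ w ∷ b ∷ F
      exchange (here eq)           = there (here eq)
      exchange (there (here eq))   = here eq
      exchange (there (there v∈))  = there (there v∈)
      term : ∀ b w → A x w * outside w F * (A b y * (outside b (w ∷ F) * R k (b ∷ w ∷ F) w b)) ≡
                     A b y * outside b F * (A x w * (outside w (b ∷ F) * R k (w ∷ b ∷ F) w b))
      term b w = begin
        A x w * outside w F * (A b y * (outside b (w ∷ F) * R k (b ∷ w ∷ F) w b))
          ≡⟨ shape₁ (A x w) (outside w F) (A b y) (outside b (w ∷ F)) _ ⟩
        A x w * A b y * (outside w F * outside b (w ∷ F)) * R k (b ∷ w ∷ F) w b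
          ≡⟨ cong₂ (λ o r → A x w * A b y * o * r) (outside-swap w b F) (R-cong k exchange exchange w b) ⟩
        A x w * A b y * (outside b F * outside w (b ∷ F)) * R k (w ∷ b ∷ F) w b
          ≡⟨ shape₂ (A x w) (A b y) (outside b F) (outside w (b ∷ F)) _ ⟩
        A b y * outside b F * (A x w * (outside w (b ∷ F) * R k (w ∷ b ∷ F) w b)) ∎

    -- Each of the `j` pairs met by the walk is revealed and becomes an ordinary edge of the path,
    -- which acquires two inner vertices. The right-hand side no longer tells matching edges of the
    -- path from the others; switching rests on this.
    ∑-P≡R : ∀ j F x y → ∑[ σ ∈ 𝓜 F ] Pᵛ σ j F x y ≡ R (j * 2) F x y
    ∑-P≡R zero    F x y = trans (∑-const (𝓜 F) (A x y)) (*-comm (H F) (A x y))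
    ∑-P≡R (suc j) F x y = begin
      ∑[ σ ∈ 𝓜 F ] ∑[ w ∈ V ] (A x w * (outside w F * Pᵛ σ j (lookup σ w ∷ w ∷ F) (lookup σ w) y))
        ≡⟨ ∑-swap (𝓜 F) V _ ⟩
      ∑[ w ∈ V ] ∑[ σ ∈ 𝓜 F ] (A x w * (outside w F * Pᵛ σ j (lookup σ w ∷ w ∷ F) (lookup σ w) y))
        ≡⟨ ∑-cong V (λ w → trans (∑-*ˡ (𝓜 F) (A x w) _)
            (cong (A x w *_) (trans (∑-*ˡ (𝓜 F) (outside w F) _) (term w)))) ⟩
      ∑[ w ∈ V ] (A x w * (outside w F * R (suc (j * 2)) (w ∷ F) w y)) ∎
      where
      open ≡-Reasoning
      term : ∀ w → outside w F * ∑[ σ ∈ 𝓜 F ] Pᵛ σ j (lookup σ w ∷ w ∷ F) (lookup σ w) y ≡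
                   outside w F * R (suc (j * 2)) (w ∷ F) w y
      term w = outside-guard w F λ w∉ → (trans
        (∑-over-partner w∉ (λ z σ → Pᵛ σ j (z ∷ w ∷ F) z y) (λ z σ τ agree → P-local j σ τ agree z y))
        (∑-cong V λ z → cong (λ t → A w z * (outside z (w ∷ F) * t)) (∑-P≡R j (z ∷ w ∷ F) z y)))

  -- Switching at an edge, and augmenting paths

  product-positive : ∀ a {b} → 0 < a * b → 0 < a × 0 < b
  product-positive (suc a) {suc b} _ = z<s , z<s
  product-positive (suc a) {zero}  p = ⊥-elim (<⇒≱ p (≤-reflexive (*-zeroʳ a)))

  positive-product : ∀ {a b} → 0 < a → 0 < b → 0 < a * b
  positive-product = *-mono-<

  module Switching {n : ℕ} (G : Graph n) where
    open Graphs n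
    open Matchings G
    open Graph G using (adjacent; symmetric; irreflexive)

    private
      A : Fin n → Fin n → ℕ
      A = adj G

      partner : Vec (Fin n) n → Fin n → Fin n
      partner = lookup

    module _ {u v : Fin n} (Auv : adjacent u v ≡ true) (j : ℕ) where

      private
        u≢v : u ≢ v
        u≢v = adjacent⇒≢ Auv

      through : List (Fin n)
      through = v ∷ u ∷ []

      -- The pair `{u, v}` itself is taken out first; together with the path from `v` to `u` it
      -- closes an alternating cycle. All `suc j` further matching edges of the cycle lie strictly
      -- inside the path.
      ∑-switch-in : ∑[ σ ∈ 𝓜 [] ] ([ partner σ u ≟ꟳ v ] * Pᵛ σ (suc j) through v u) ≡ R (suc j * 2) through
          v u
      ∑-switch-in = begin
        ∑[ σ ∈ 𝓜 [] ] ([ partner σ u ≟ꟳ v ] * Pᵛ σ (suc j) through v u)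
          ≡⟨ ∑-matched-to (λ ()) (λ σ → Pᵛ σ (suc j) through v u)
              (λ σ τ agree → P-local (suc j) σ τ agree v u) ⟩
        A u v * (outside v (u ∷ []) * ∑[ σ ∈ 𝓜 through ] Pᵛ σ (suc j) through v u)
          ≡⟨ cong₂ _*_ (cong 𝟙 Auv) (cong₂ _*_ (outside-∉ {F = u ∷ []} λ { (here eq) → u≢v (sym eq) })
              (∑-P≡R (suc j) through v u)) ⟩
        1 * (1 * R (suc j * 2) through v u)
          ≡⟨ trans (*-identityˡ _) (*-identityˡ _) ⟩
        R (suc j * 2) through v u ∎
        where open ≡-Reasoning

      -- Listed in the order of revelation, the partner of `v` before that of `u`, since each
      -- revelation extends the list at its front.
      avoiding : Vec (Fin n) n → List (Fin n)
      avoiding σ = partner σ u ∷ u ∷ partner σ v ∷ v ∷ []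

      -- Here the path from `v` to `u` begins and ends with a matching edge, so only `j` pairs are
      -- left between the partners of `v` and `u`. The number of inner vertices is the same as in
      -- `∑-switch-in`, and both sums meet in one value of `R`.
      ∑-switch-out : ∑[ σ ∈ 𝓜 [] ] ([ ¬? (partner σ u ≟ꟳ v) ] * Pᵛ σ j (avoiding σ) (partner σ v)
          (partner σ u)) ≡ R (suc j * 2) through v u
      ∑-switch-out = begin
        ∑[ σ ∈ 𝓜 [] ] ([ ¬? (partner σ u ≟ꟳ v) ] * Pᵛ σ j (avoiding σ) (partner σ v) (partner σ u))
          ≡⟨ ∑-cong-∈ (𝓜 []) (λ σ σ∈ → cong (_* Pᵛ σ j (avoiding σ) (partner σ v) (partner σ u))
              (unmatched σ σ∈)) ⟩
        ∑[ σ ∈ 𝓜 [] ] Φ (partner σ v) σ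
          ≡⟨ ∑-over-partner (λ ()) Φ Φ-local ⟩
        ∑[ a ∈ V ] (A v a * (outside a (v ∷ []) * ∑ (𝓜 (a ∷ v ∷ [])) (Φ a)))
          ≡⟨ ∑-cong V (λ a → cong (A v a *_) (term a)) ⟩
        R (suc j * 2) through v u ∎
        where
        open ≡-Reasoning
        -- The condition that `u` and `v` are not matched is expressed through the partner `a` of
        -- `v`, so that `Φ a` depends on the matching outside `a` and `v` only.
        Φ : Fin n → Vec (Fin n) n → ℕ
        Φ a σ = outside u (a ∷ v ∷ []) * Pᵛ σ j (partner σ u ∷ u ∷ a ∷ v ∷ []) a (partner σ u)

        Φ-local : ∀ a σ τ → AgreeOutside (a ∷ v ∷ []) σ τ → Φ a σ ≡ Φ a τ
        Φ-local a σ τ agree = outside-guard u (a ∷ v ∷ []) λ u∉ →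
          trans (cong (λ b → Pᵛ σ j (b ∷ u ∷ a ∷ v ∷ []) a b) (agree u u∉))
              (P-local j σ τ (λ w w∉ → agree w (w∉ ∘ there ∘ there)) a _)

        unmatched : ∀ σ → σ ∈ 𝓜 [] → [ ¬? (partner σ u ≟ꟳ v) ] ≡ outside u (partner σ v ∷ v ∷ [])
        unmatched σ σ∈ = []-cong (¬? (partner σ u ≟ꟳ v)) (¬? (u ∈ꟳ? (partner σ v ∷ v ∷ [])))
          (λ ne → λ { (here eq) → ne (trans (cong (lookup σ) eq) (proj₁ (m v))) ; (there (here eq)) → u≢v eq
              })
          (λ u∉ eq → u∉ (here (trans (sym (proj₁ (m u))) (cong (lookup σ) eq))))
          where m = ∈-𝓜⁻ σ∈

        reorder₁ : ∀ {a} → u ∷ a ∷ v ∷ [] ⊆ a ∷ through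
        reorder₁ (here eq)                 = there (there (here eq))
        reorder₁ (there (here eq))         = here eq
        reorder₁ (there (there (here eq))) = there (here eq)

        reorder₂ : ∀ {a} → a ∷ through ⊆ u ∷ a ∷ v ∷ []
        reorder₂ (here eq)                 = there (here eq)
        reorder₂ (there (here eq))         = there (there (here eq))
        reorder₂ (there (there (here eq))) = here eq

        avoids : ∀ a → outside a (v ∷ []) * outside u (a ∷ v ∷ []) ≡ outside a through
        avoids a with a ∈ꟳ? through
        ... | no a∉ = trans (cong₂ _*_ (outside-∉ {F = v ∷ []} λ { (here eq) → a∉ (here eq) })
                                       (outside-∉ {F = a ∷ v ∷ []} λ { (here eq) → a∉
                                           (there (here (sym eq))) ; (there (here eq)) → u≢v eq }))
                            (sym (outside-∉ a∉))
        ... | yes a∈@(here eq) = trans (cong (_* outside u (a ∷ v ∷ [])) (outside-∈ {F = v ∷ []} (here eq)))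
            (sym (outside-∈ a∈))
        ... | yes a∈@(there (here eq)) = trans
            (trans (cong (outside a (v ∷ []) *_) (outside-∈ {F = a ∷ v ∷ []} (here (sym eq))))
            (*-zeroʳ (outside a (v ∷ []))))
                                               (sym (outside-∈ a∈))

        rest : ∀ a → outside u (a ∷ v ∷ []) * ∑[ σ ∈ 𝓜 (a ∷ v ∷ []) ] Pᵛ σ j (partner σ u ∷ u ∷ a ∷ v ∷ [])
            a (partner σ u) ≡
                     outside u (a ∷ v ∷ []) * R (suc (j * 2)) (a ∷ through) a u
        rest a = outside-guard u (a ∷ v ∷ []) λ u∉ → (begin
          ∑[ σ ∈ 𝓜 (a ∷ v ∷ []) ] Pᵛ σ j (partner σ u ∷ u ∷ a ∷ v ∷ []) a (partner σ u)
            ≡⟨ ∑-over-partner u∉ (λ b σ → Pᵛ σ j (b ∷ u ∷ a ∷ v ∷ []) a b)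
                (λ b σ τ agree → P-local j σ τ agree a b) ⟩
          ∑[ b ∈ V ] (A u b * (outside b (u ∷ a ∷ v ∷ []) * ∑[ σ ∈ 𝓜 (b ∷ u ∷ a ∷ v ∷ []) ] Pᵛ σ j
              (b ∷ u ∷ a ∷ v ∷ []) a b))
            ≡⟨ ∑-cong V (λ b → cong₂ _*_ (cong 𝟙 (symmetric u b))
                 (cong₂ _*_ (outside-cong {w = b} (reorder₁ {a}) reorder₂)
                            (trans (∑-P≡R j (b ∷ u ∷ a ∷ v ∷ []) a b)
                                (R-cong (j * 2) (⊆-∷-cong b reorder₁) (⊆-∷-cong b reorder₂) a b)))) ⟩
          ∑[ b ∈ V ] (A b u * (outside b (a ∷ through) * R (j * 2) (b ∷ a ∷ through) a b))
            ≡⟨ R-expand-end (j * 2) (a ∷ through) a u ⟨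
          R (suc (j * 2)) (a ∷ through) a u ∎)

        term : ∀ a → outside a (v ∷ []) * ∑ (𝓜 (a ∷ v ∷ [])) (Φ a) ≡ outside a through * R (suc (j * 2))
            (a ∷ through) a u
        term a = begin
          outside a (v ∷ []) * ∑ (𝓜 (a ∷ v ∷ [])) (Φ a)
            ≡⟨ cong (outside a (v ∷ []) *_)
                (trans (∑-*ˡ (𝓜 (a ∷ v ∷ [])) (outside u (a ∷ v ∷ [])) _) (rest a)) ⟩
          outside a (v ∷ []) * (outside u (a ∷ v ∷ []) * R (suc (j * 2)) (a ∷ through) a u)
            ≡⟨ *-assoc (outside a (v ∷ [])) (outside u (a ∷ v ∷ [])) _ ⟨
          outside a (v ∷ []) * outside u (a ∷ v ∷ []) * R (suc (j * 2)) (a ∷ through) a u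
            ≡⟨ cong (_* R (suc (j * 2)) (a ∷ through) a u) (avoids a) ⟩
          outside a through * R (suc (j * 2)) (a ∷ through) a u ∎

    H-add-edge : ∀ {x y F} → 0 < A x y → Unique (x ∷ y ∷ F) → 0 < H (x ∷ y ∷ F) → 0 < H F
    H-add-edge {x} {y} {F} Axy ((x≢y ∷ x∉F) ∷ y∉F ∷ _) pos = begin-strict
      0
          <⟨ positive-product (subst (0 <_) (cong 𝟙 (symmetric x y)) Axy) (positive-product outside>0 pos) ⟩
      A y x * (outside x (y ∷ F) * H (x ∷ y ∷ F))
          ≡⟨ cong (λ h → A y x * (outside x (y ∷ F) * h)) (count (x ∷ y ∷ F)) ⟨
      A y x * (outside x (y ∷ F) * ∑[ σ ∈ 𝓜 (x ∷ y ∷ F) ] 1)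
        ≡⟨ ∑-matched-to (λ y∈ → All.lookup y∉F y∈ refl) (λ _ → 1) (λ _ _ _ → refl) ⟨
      ∑[ σ ∈ 𝓜 F ] ([ partner σ y ≟ꟳ x ] * 1)
          ≤⟨ ∑-mono (𝓜 F) (λ σ → *-monoˡ-≤ 1 (𝟙≤1 (does (partner σ y ≟ꟳ x)))) ⟩
      ∑[ σ ∈ 𝓜 F ] (1 * 1)                           ≡⟨ count F ⟩
      H F                                            ∎
      where
      open ≤-Reasoning
      count : ∀ F → ∑[ σ ∈ 𝓜 F ] 1 ≡ H F
      count F = trans (∑-const (𝓜 F) 1) (*-identityʳ (H F))
      outside>0 : 0 < outside x (y ∷ F)
      outside>0 = ≤-reflexive (sym (outside-∉ {F = y ∷ F}
          λ { (here eq) → x≢y eq ; (there x∈) → All.lookup x∉F x∈ refl }))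

    R-suc-positive : ∀ k {F x y} → 0 < R (suc k) F x y → ∃[ w ] 0 < A x w × w ∉ F × 0 < R k (w ∷ F) w y
    R-suc-positive k {F} {x} pos with ∑-positive V _ pos
    ... | w , _ , p with product-positive (A x w) p
    ...   | Axw , q with product-positive (outside w F) q
    ...     | o , r = w , Axw , outside-positive {w = w} {F} o , r

    ∉⇒all-≢ : ∀ {x : Fin n} {F} → x ∉ F → All (x ≢_) F
    ∉⇒all-≢ {F = F} x∉ = All.tabulate {xs = F} λ y∈ eq → x∉ (subst (_∈ F) (sym eq) y∈)

    -- Matching the path off in pairs starting from its end x covers x and y too.
    R-augment : ∀ j {x y F} → Unique (x ∷ y ∷ F) → 0 < R (j * 2) (x ∷ y ∷ F) x y → 0 < H F
    R-augment zero    {x} {y} u pos = H-add-edge (proj₁ (product-positive (A x y) pos)) u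
        (proj₂ (product-positive (A x y) pos))
    R-augment (suc j) {x} {y} {F} u@((x≢y ∷ x∉F) ∷ (y∉F ∷ uF)) pos with R-suc-positive (suc (j * 2)) pos
    ... | w , Axw , w∉ , pos₁ with R-suc-positive (j * 2) pos₁
    ...   | z , Awz , z∉ , pos₂ =
      H-add-edge (subst (0 <_) (cong 𝟙 (symmetric x w)) Axw) uwx
        (R-augment j uzy (subst (0 <_) (R-cong (j * 2) reorder₁ reorder₂ z y) pos₂))
      where
      uwx : Unique (w ∷ x ∷ F)
      uwx = ∉⇒all-≢ (λ { (here eq) → w∉ (here eq) ; (there w∈) → w∉ (there (there w∈)) }) ∷ x∉F ∷ uF
      y∉wx : y ∉ w ∷ x ∷ F
      y∉wx (here eq)           = w∉ (there (here (sym eq)))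
      y∉wx (there (here eq))   = x≢y (sym eq)
      y∉wx (there (there y∈))  = All.lookup y∉F y∈ refl
      reorder₁ : z ∷ w ∷ x ∷ y ∷ F ⊆ z ∷ y ∷ w ∷ x ∷ F
      reorder₁ (here eq)                         = here eq
      reorder₁ (there (here eq))                 = there (there (here eq))
      reorder₁ (there (there (here eq)))         = there (there (there (here eq)))
      reorder₁ (there (there (there (here eq)))) = there (here eq)
      reorder₁ (there (there (there (there v∈)))) = there (there (there (there v∈)))
      reorder₂ : z ∷ y ∷ w ∷ x ∷ F ⊆ z ∷ w ∷ x ∷ y ∷ F
      reorder₂ (here eq)                         = here eq
      reorder₂ (there (here eq))                 = there (there (there (here eq)))
      reorder₂ (there (there (here eq)))         = there (here eq)
      reorder₂ (there (there (there (here eq)))) = there (there (here eq))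
      reorder₂ (there (there (there (there v∈)))) = there (there (there (there v∈)))
      uzy : Unique (z ∷ y ∷ w ∷ x ∷ F)
      uzy = ∉⇒all-≢ (z∉ ∘ tail) ∷ ∉⇒all-≢ y∉wx ∷ uwx
        where
        tail : ∀ {v} → v ∈ y ∷ w ∷ x ∷ F → v ∈ w ∷ x ∷ y ∷ F
        tail (here eq)                   = there (there (here eq))
        tail (there (here eq))           = here eq
        tail (there (there (here eq)))   = there (here eq)
        tail (there (there (there v∈)))  = there (there (there v∈))

    -- An alternating path is cut at the first unmatched vertex it meets.
    P-truncate : ∀ {F₀ σ} → IsMatching F₀ σ → ∀ j {S F x y} → y ∈ F₀ → y ∉ S →
        (∀ {v} → v ∈ F → v ∈ S ⊎ v ∈ F₀) →
                 0 < Pᵛ σ j S x y → ∃[ j′ ] ∃[ y′ ] (y′ ∈ F₀ × y′ ∉ S × 0 < Pᵛ σ j′ F x y′)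
    P-truncate m zero {y = y} y∈ y∉ F⊆ pos = 0 , y , y∈ , y∉ , pos
    P-truncate {F₀} {σ} m (suc j) {S} {F} {x} {y} y∈ y∉ F⊆ pos with ∑-positive V _ pos
    ... | w , _ , p with product-positive (A x w) p
    ...   | Axw , q with product-positive (outside w S) q | w ∈ꟳ? F₀
    -- An uncovered vertex ends the path here. Having passed the test against `S`, it differs from
    -- the start.
    ...     | o , r | yes w∈ = 0 , w , w∈ , outside-positive {w = w} {S} o , Axw
    ...     | o , r | no w∉F₀ with P-truncate {F₀} {σ} m j {F = partner σ w ∷ w ∷ F} y∈ y∉⁺ F⊆⁺ r
      where
      σy≡y : partner σ y ≡ y
      σy≡y = proj₁ (proj₂ (m y)) y∈
      y∉⁺ : y ∉ partner σ w ∷ w ∷ S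
      y∉⁺ (here eq)          = w∉F₀ (subst (_∈ F₀)
          (trans (trans (sym σy≡y) (cong (partner σ) eq)) (proj₁ (m w))) y∈)
      y∉⁺ (there (here eq))  = w∉F₀ (subst (_∈ F₀) eq y∈)
      y∉⁺ (there (there y∈)) = y∉ y∈
      F⊆⁺ : ∀ {v} → v ∈ partner σ w ∷ w ∷ F → v ∈ partner σ w ∷ w ∷ S ⊎ v ∈ F₀
      F⊆⁺ (here eq)          = inj₁ (here eq)
      F⊆⁺ (there (here eq))  = inj₁ (there (here eq))
      F⊆⁺ (there (there v∈)) = [ inj₁ ∘ there ∘ there , inj₂ ]′ (F⊆ v∈)
    ...       | j′ , y′ , y′∈ , y′∉ , r′ = suc j′ , y′ , y′∈ , y′∉ ∘ there ∘ there ,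
      ≤-trans (positive-product Axw (positive-product (≤-reflexive (sym (outside-∉ w∉F))) r′))
        (∑-member (λ w → A x w * (outside w F * Pᵛ σ j′ (partner σ w ∷ w ∷ F) (partner σ w) y′))
            (∈-allFin w))
      where
      w∉F : w ∉ F
      w∉F w∈ = [ outside-positive {w = w} {S} o , w∉F₀ ]′ (F⊆ w∈)

    module _ (connected : ∀ (σ : Vec (Fin n) n) → (∀ v → partner σ (partner σ v) ≡ v) → ∀ x y → ∃[ j ] 0 <
        Pᵛ σ j (x ∷ []) x y) where

      -- `F` is the set of uncovered vertices of some matching, and each round covers two of them.
      -- The truncated path may end at an uncovered vertex `y′` other than `y`, so `F` is rearranged
      -- to bring `y′` next to `x`.
      H-descend : ∀ k {F} → length F ≡ k * 2 → Unique F → 0 < H F → 0 < H []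
      H-descend zero    {[]}         len u pos = pos
      H-descend (suc k) {x ∷ y ∷ F} len u@((x≢y ∷ _) ∷ _) pos
        with ∑-positive (𝓜 (x ∷ y ∷ F)) (λ _ → 1)
            (subst (0 <_) (sym (trans (∑-const (𝓜 (x ∷ y ∷ F)) 1) (*-identityʳ _))) pos)
      ... | σ , σ∈ , _ with connected σ (λ v → proj₁ (∈-𝓜⁻ σ∈ v)) x y
      ...   | j , p with P-truncate {x ∷ y ∷ F} {σ} (∈-𝓜⁻ σ∈) j {x ∷ []} {x ∷ y ∷ F} (there (here refl))
          (λ { (here eq) → x≢y (sym eq) }) inj₂ p
      ...     | j′ , y′ , here eq , y′∉ , p′ = ⊥-elim (y′∉ (here eq))
      ...     | j′ , y′ , there y′∈ , y′∉ , p′ with ∈-∃++ y′∈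
      ...       | as , bs , eq = H-descend k {as ++ bs} len′ uF′
          (R-augment j′ u′ (subst (0 <_) (R-cong (j′ * 2) (∈-resp-↭ perm) (∈-resp-↭ (↭-sym perm)) x y′)
          R>0))
        where
        perm : x ∷ y ∷ F ↭ x ∷ y′ ∷ as ++ bs
        perm = ↭-prep x (subst (_↭ y′ ∷ as ++ bs) (sym eq) (shift y′ as bs))
        u′ : Unique (x ∷ y′ ∷ as ++ bs)
        u′ = Unique-resp-↭ (setoid (Fin n)) (↭⇒↭ₛ perm) u
        uF′ : Unique (as ++ bs)
        uF′ with u′
        ... | _ ∷ _ ∷ uF = uF
        len′ : length (as ++ bs) ≡ k * 2
        len′ = suc-injective (suc-injective (trans (sym (↭-length perm)) len))
        R>0 : 0 < R (j′ * 2) (x ∷ y ∷ F) x y′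
        R>0 = subst (0 <_) (∑-P≡R j′ (x ∷ y ∷ F) x y′)
          (≤-trans p′ (∑-member (λ σ → Pᵛ σ j′ (x ∷ y ∷ F) x y′) σ∈))

      perfect-matching-exists : 2 ∣ n → 0 < H []
      perfect-matching-exists (divides k n≡k2) = H-descend k {V} (trans length-V n≡k2) (allFin⁺ n)
        -- The start is the empty matching, with every vertex uncovered.
        (positive (∈-𝓜⁺ {V} {tabulate id} (tabulate-matches identity)))
        where
        identity : Matches V id
        identity v = refl , (λ _ → refl) , λ v∉ → ⊥-elim (v∉ (∈-allFin v))
        positive : ∀ {σ : Vec (Fin n) n} {xs} → σ ∈ xs → 1 ≤ length xs
        positive (here _)  = s≤s z≤n
        positive (there _) = s≤s z≤n

  -- Matchings as edge sets

  module _ {a} {A : Set a} where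

    ∈-subsets⇒⊆ : ∀ {xs M : List A} → M ∈ subsets xs → M ⊆ xs
    ∈-subsets⇒⊆ {[]} (here refl) e∈ = e∈
    ∈-subsets⇒⊆ {x ∷ xs} M∈ e∈ with ∈-++⁻ (map (x ∷_) (subsets xs)) M∈
    ... | inj₂ M∈′ = there (∈-subsets⇒⊆ M∈′ e∈)
    ... | inj₁ M∈′ with ∈-map⁻ (x ∷_) M∈′
    ∈-subsets⇒⊆ M∈ (here eq)  | inj₁ _ | M′ , M′∈ , refl = here eq
    ∈-subsets⇒⊆ M∈ (there e∈) | inj₁ _ | M′ , M′∈ , refl = there (∈-subsets⇒⊆ M′∈ e∈)

    subsets-unique : ∀ {xs : List A} → Unique xs → Unique (subsets xs)
    subsets-unique {[]}     []       = [] ∷ []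
    subsets-unique {x ∷ xs} (x∉ ∷ u) = ++⁺ (map-unique (x ∷_) (λ _ _ → ∷-injectiveʳ) (subsets-unique u))
        (subsets-unique u) disjoint
      where
      disjoint : ∀ {M} → M ∈ map (x ∷_) (subsets xs) × M ∈ subsets xs → ⊥
      disjoint (p , q) with ∈-map⁻ (x ∷_) p
      ... | M′ , _ , refl = All.lookup x∉ (∈-subsets⇒⊆ q (here refl)) refl

    module _ {p} {P : Pred A p} (P? : Decidable P) where

      filter-∈-subsets : ∀ xs → filter P? xs ∈ subsets xs
      filter-∈-subsets []       = here refl
      filter-∈-subsets (x ∷ xs) with does (P? x)
      ... | true  = ∈-++⁺ˡ (∈-map⁺ (x ∷_) (filter-∈-subsets xs))
      ... | false = ∈-++⁺ʳ (map (x ∷_) (subsets xs)) (filter-∈-subsets xs)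

      -- A sublist of a list without repetitions is determined by its members. This recovers a
      -- matching, as a list, from its involution.
      filter-≡-subset : ∀ {xs M} → Unique xs → M ∈ subsets xs →
          (∀ {e} → e ∈ xs → (P e → e ∈ M) × (e ∈ M → P e)) → filter P? xs ≡ M
      filter-≡-subset {[]} u (here refl) h = refl
      filter-≡-subset {x ∷ xs} {M} (x∉ ∷ u) M∈ h with ∈-++⁻ (map (x ∷_) (subsets xs)) M∈
      ... | inj₁ M∈′ with ∈-map⁻ (x ∷_) M∈′
      ...   | M′ , M′∈ , refl with P? x
      ...     | no ¬Px = ⊥-elim (¬Px (proj₂ (h (here refl)) (here refl)))
      ...     | yes _  = cong (x ∷_) (filter-≡-subset u M′∈ λ e∈ → tail e∈ ∘ proj₁ (h (there e∈)) , proj₂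
          (h (there e∈)) ∘ there)
        where
        tail : ∀ {e} → e ∈ xs → e ∈ x ∷ M′ → e ∈ M′
        tail e∈ (here refl) = ⊥-elim (All.lookup x∉ e∈ refl)
        tail e∈ (there e∈′) = e∈′
      filter-≡-subset {x ∷ xs} {M} (x∉ ∷ u) M∈ h | inj₂ M∈′ with P? x
      ...   | yes Px = ⊥-elim (All.lookup x∉ (∈-subsets⇒⊆ M∈′ (proj₁ (h (here refl)) Px)) refl)
      ...   | no _   = filter-≡-subset u M∈′ (h ∘ there)

    length-singleton : ∀ {e : A} {xs} → Unique xs → e ∈ xs → (∀ {e′} → e′ ∈ xs → e′ ≡ e) → length xs ≡ 1
    length-singleton {xs = x ∷ []}     u e∈ h = refl
    length-singleton {xs = x ∷ y ∷ xs} ((x≢y ∷ _) ∷ _) e∈ h = ⊥-elim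
        (x≢y (trans (h (here refl)) (sym (h (there (here refl))))))

  module Encoding {n : ℕ} (G : Graph n) where
    open Graphs n
    open Matchings G
    open Graph G using (adjacent; symmetric; irreflexive)

    edges-unique : Unique (edges G)
    edges-unique = filter⁺ _ (cartesianProduct⁺ (allFin⁺ n) (allFin⁺ n))

    ∈-edges⁻ : ∀ {u v} → (u , v) ∈ edges G → u Fin.< v × adjacent u v ≡ true
    ∈-edges⁻ e∈ = proj₂ (∈-filter⁻ _ {xs = cartesianProduct (allFin n) (allFin n)} e∈)

    ∈-edges⁺ : ∀ {u v} → u Fin.< v → adjacent u v ≡ true → (u , v) ∈ edges G
    ∈-edges⁺ u<v Auv = ∈-filter⁺ _ (∈-cartesianProduct⁺ (∈-allFin _) (∈-allFin _)) (u<v , Auv)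

    perfectMatchings-unique : Unique (perfectMatchings G)
    perfectMatchings-unique = filter⁺ isPerfectMatching? (subsets-unique edges-unique)

    otherEnd : Fin n → Edge n → Fin n
    otherEnd v (a , b) with v ≟ꟳ a
    ... | yes _ = b
    ... | no _  = a

    -- The value at `[]` is a default; for a perfect matching the list of incident edges has exactly
    -- one entry.
    mateIn : List (Edge n) → Fin n → Fin n
    mateIn []      v = v
    mateIn (e ∷ _) v = otherEnd v e

    mate : List (Edge n) → Fin n → Fin n
    mate M v = mateIn (filter (incident? v) M) v

    otherEnd-first : ∀ {a b} → otherEnd a (a , b) ≡ b
    otherEnd-first {a} with a ≟ꟳ a
    ... | yes _  = refl
    ... | no a≢a = ⊥-elim (a≢a refl)

    otherEnd-second : ∀ {a b} → a ≢ b → otherEnd b (a , b) ≡ a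
    otherEnd-second {a} {b} a≢b with b ≟ꟳ a
    ... | yes eq = ⊥-elim (a≢b (sym eq))
    ... | no _   = refl

    module _ {M : List (Edge n)} (perfect : IsPerfectMatching M) where

      mate-otherEnd : ∀ {v e} → e ∈ M → Incident v e → mate M v ≡ otherEnd v e
      mate-otherEnd {v} {e} e∈ inc with filter (incident? v) M | perfect v | ∈-filter⁺ (incident? v) e∈ inc
      ... | e′ ∷ [] | _ | here eq = cong (otherEnd v) (sym eq)

      covering-edge : ∀ v → ∃[ e ] e ∈ M × Incident v e
      covering-edge v with filter (incident? v) M in eq | perfect v
      ... | e ∷ [] | _ = e , ∈-filter⁻ (incident? v) (subst (e ∈_) (sym eq) (here refl))

      module _ (M⊆ : M ⊆ edges G) where

        edge⇒mate : ∀ {a b} → (a , b) ∈ M → mate M a ≡ b × mate M b ≡ a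
        edge⇒mate {a} {b} e∈ = trans (mate-otherEnd e∈ (inj₁ refl)) (otherEnd-first {a} {b})
                     , trans (mate-otherEnd e∈ (inj₂ refl))
                         (otherEnd-second (adjacent⇒≢ (proj₂ (∈-edges⁻ (M⊆ e∈)))))

        mate⇒edge : ∀ v → (v , mate M v) ∈ M ⊎ (mate M v , v) ∈ M
        mate⇒edge v with covering-edge v
        ... | (a , b) , e∈ , inj₁ refl = inj₁ (subst (λ w → (a , w) ∈ M) (sym (proj₁ (edge⇒mate e∈))) e∈)
        ... | (a , b) , e∈ , inj₂ refl = inj₂ (subst (λ w → (w , b) ∈ M) (sym (proj₂ (edge⇒mate e∈))) e∈)

        mate-matches : Matches [] (mate M)
        mate-matches v with mate⇒edge v
        ... | inj₁ e∈ = proj₂ (edge⇒mate e∈) , (λ ()) , λ _ → proj₂ (∈-edges⁻ (M⊆ e∈))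
        ... | inj₂ e∈ = proj₁ (edge⇒mate e∈) , (λ ()) , λ _ → trans (symmetric v (mate M v))
            (proj₂ (∈-edges⁻ (M⊆ e∈)))

        mate≡⇒edge : ∀ {a b} → (a , b) ∈ edges G → mate M a ≡ b → (a , b) ∈ M
        mate≡⇒edge {a} ab∈ refl with mate⇒edge a
        ... | inj₁ e∈ = e∈
        ... | inj₂ e∈ = ⊥-elim (Finₚ.<-asym (proj₁ (∈-edges⁻ ab∈)) (proj₁ (∈-edges⁻ (M⊆ e∈))))

    matchedBy? : ∀ (s : Fin n → Fin n) → Decidable {A = Edge n} (λ e → s (proj₁ e) ≡ proj₂ e)
    matchedBy? s (a , b) = s a ≟ꟳ b

    edgeSet : (Fin n → Fin n) → List (Edge n)
    edgeSet s = filter (matchedBy? s) (edges G)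

    module _ {s : Fin n → Fin n} (m : Matches [] s) where

      edgeSet⁻ : ∀ {a b} → (a , b) ∈ edgeSet s → (a , b) ∈ edges G × s a ≡ b
      edgeSet⁻ = ∈-filter⁻ (matchedBy? s) {xs = edges G}

      ∈-edgeSet : ∀ v → (v , s v) ∈ edgeSet s ⊎ (s v , v) ∈ edgeSet s
      ∈-edgeSet v with Finₚ.<-cmp v (s v)
      ... | tri< v<sv _ _ = inj₁ (∈-filter⁺ (matchedBy? s) (∈-edges⁺ v<sv (proj₂ (proj₂ (m v)) λ ())) refl)
      ... | tri≈ _ eq _   = ⊥-elim (adjacent⇒≢ (proj₂ (proj₂ (m v)) λ ()) eq)
      ... | tri> _ _ sv<v = inj₂ (∈-filter⁺ (matchedBy? s)
          (∈-edges⁺ sv<v (trans (symmetric (s v) v) (proj₂ (proj₂ (m v)) λ ()))) (proj₁ (m v)))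

      edgeSet-perfect : IsPerfectMatching (edgeSet s)
      edgeSet-perfect v with ∈-edgeSet v
      ... | inj₁ e∈ = length-singleton (filter⁺ (incident? v) (filter⁺ (matchedBy? s) edges-unique))
          (∈-filter⁺ (incident? v) e∈ (inj₁ refl)) only
        where
        only : ∀ {e} → e ∈ filter (incident? v) (edgeSet s) → e ≡ (v , s v)
        only {a , b} p with ∈-filter⁻ (incident? v) {xs = edgeSet s} p
        ... | e′∈ , inj₁ refl = cong (v ,_) (sym (proj₂ (edgeSet⁻ e′∈)))
        ... | e′∈ , inj₂ refl with edgeSet⁻ e′∈
        ...   | e′∈G , refl = ⊥-elim (Finₚ.<-asym (proj₁ (∈-edges⁻ e′∈G))
            (subst (s a Fin.<_) (proj₁ (m a)) (proj₁ (∈-edges⁻ (proj₁ (edgeSet⁻ e∈))))))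
      ... | inj₂ e∈ = length-singleton (filter⁺ (incident? v) (filter⁺ (matchedBy? s) edges-unique))
          (∈-filter⁺ (incident? v) e∈ (inj₂ refl)) only
        where
        only : ∀ {e} → e ∈ filter (incident? v) (edgeSet s) → e ≡ (s v , v)
        only {a , b} p with ∈-filter⁻ (incident? v) {xs = edgeSet s} p
        ... | e′∈ , inj₂ refl = cong (_, b) (trans (sym (proj₁ (m a))) (cong s (proj₂ (edgeSet⁻ e′∈))))
        ... | e′∈ , inj₁ refl with edgeSet⁻ e′∈
        ...   | e′∈G , refl = ⊥-elim (Finₚ.<-asym (proj₁ (∈-edges⁻ e′∈G))
            (proj₁ (∈-edges⁻ (proj₁ (edgeSet⁻ e∈)))))

      edgeSet-⊆ : edgeSet s ⊆ edges G
      edgeSet-⊆ p = proj₁ (∈-filter⁻ (matchedBy? s) {xs = edges G} p)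

      mate-edgeSet : ∀ v → mate (edgeSet s) v ≡ s v
      mate-edgeSet v with ∈-edgeSet v
      ... | inj₁ e∈ = proj₁ (edge⇒mate edgeSet-perfect edgeSet-⊆ e∈)
      ... | inj₂ e∈ = proj₂ (edge⇒mate edgeSet-perfect edgeSet-⊆ e∈)

    -- `mate` and `edgeSet` are mutually inverse. Taking `f` and `g` constant gives the number of
    -- matchings, taking indicators gives the number that contain a given edge.
    ∑-perfectMatchings : ∀ (f : List (Edge n) → ℕ) (g : Vec (Fin n) n → ℕ) →
                         (∀ {M σ} → M ∈ perfectMatchings G → (∀ v → lookup σ v ≡ mate M v) → f M ≡ g σ) →
                         ∑ (perfectMatchings G) f ≡ ∑ (𝓜 []) g
    ∑-perfectMatchings f g f≡g = ∑-bijection h k f g perfectMatchings-unique (𝓜-unique []) to from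
      where
      h : List (Edge n) → Vec (Fin n) n
      h M = tabulate (mate M)
      k : Vec (Fin n) n → List (Edge n)
      k σ = edgeSet (lookup σ)
      to : ∀ {M} → M ∈ perfectMatchings G → h M ∈ 𝓜 [] × k (h M) ≡ M × f M ≡ g (h M)
      to {M} M∈ with ∈-filter⁻ isPerfectMatching? {xs = subsets (edges G)} M∈
      ... | M∈′ , perfect = ∈-𝓜⁺ {[]} {h M} (tabulate-matches (mate-matches perfect M⊆))
          , filter-≡-subset (matchedBy? (lookup (h M))) edges-unique M∈′ (λ {e} e∈ →
              (λ eq → mate≡⇒edge perfect M⊆ e∈ (trans (sym (lookup∘tabulate (mate M) (proj₁ e))) eq)) ,
              (λ e∈M → trans (lookup∘tabulate (mate M) (proj₁ e)) (proj₁ (edge⇒mate perfect M⊆ e∈M))))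
          , f≡g M∈ (lookup∘tabulate (mate M))
        where
        M⊆ : M ⊆ edges G
        M⊆ = ∈-subsets⇒⊆ M∈′
      from : ∀ {σ} → σ ∈ 𝓜 [] → k σ ∈ perfectMatchings G × h (k σ) ≡ σ
      from {σ} σ∈ = ∈-filter⁺ isPerfectMatching? (filter-∈-subsets (matchedBy? (lookup σ)) (edges G))
          (edgeSet-perfect m)
          , lookup-extensional (λ v → trans (lookup∘tabulate (mate (k σ)) v) (mate-edgeSet m v))
        where
        m : Matches [] (lookup σ)
        m = ∈-𝓜⁻ {[]} {σ} σ∈

    length-perfectMatchings : length (perfectMatchings G) ≡ H []
    length-perfectMatchings = begin
      length (perfectMatchings G)          ≡⟨ trans (∑-const (perfectMatchings G) 1) (*-identityʳ _) ⟨
      ∑[ M ∈ perfectMatchings G ] 1        ≡⟨ ∑-perfectMatchings (λ _ → 1) (λ _ → 1) (λ _ _ → refl) ⟩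
      ∑[ σ ∈ 𝓜 [] ] 1                      ≡⟨ trans (∑-const (𝓜 []) 1) (*-identityʳ _) ⟩
      H []                                 ∎
      where open ≡-Reasoning

    length-containing : ∀ {u v} → (u , v) ∈ edges G →
                        length (filter ((u , v) ∈?_) (perfectMatchings G)) ≡ ∑[ σ ∈ 𝓜 [] ]
                            [ lookup σ u ≟ꟳ v ]
    length-containing {u} {v} e∈ = trans (length-filter-≡-∑ ((u , v) ∈?_) (perfectMatchings G))
      (∑-perfectMatchings (λ M → [ (u , v) ∈? M ]) (λ σ → [ lookup σ u ≟ꟳ v ]) λ {M} {σ} → contained {M}
          {σ})
      where
      contained : ∀ {M σ} → M ∈ perfectMatchings G → (∀ v → lookup σ v ≡ mate M v) → [ (u , v) ∈? M ] ≡
          [ lookup σ u ≟ꟳ v ]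
      contained {M} {σ} M∈ eq with ∈-filter⁻ isPerfectMatching? {xs = subsets (edges G)} M∈
      ... | M∈′ , perfect = []-cong ((u , v) ∈? M) (lookup σ u ≟ꟳ v)
        (λ e∈M → trans (eq u) (proj₁ (edge⇒mate perfect (∈-subsets⇒⊆ M∈′) e∈M)))
        (λ su≡v → mate≡⇒edge perfect (∈-subsets⇒⊆ M∈′) e∈ (trans (sym (eq u)) su≡v))

  -- Counting matchings through an edge

  module _ {a} {A : Set a} where

    ∑-weighted-≤ : ∀ (xs : List A) (ι p : A → ℕ) {c e} → (∀ x → x ∈ xs → c * p x ≤ e) → c * ∑[ x ∈ xs ]
        (ι x * p x) ≤ e * ∑ xs ι
    ∑-weighted-≤ xs ι p {c} {e} h = begin
      c * ∑[ x ∈ xs ] (ι x * p x)          ≡⟨ ∑-*ˡ xs c _ ⟨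
      ∑[ x ∈ xs ] (c * (ι x * p x))
          ≤⟨ ∑-mono-∈ xs (λ x x∈ → ≤-trans (≤-reflexive (shape c (ι x) (p x))) (*-monoʳ-≤ (ι x) (h x x∈))) ⟩
      ∑[ x ∈ xs ] (ι x * e)                ≡⟨ trans (∑-*ʳ xs e ι) (*-comm (∑ xs ι) e) ⟩
      e * ∑ xs ι                           ∎
      where
      open ≤-Reasoning
      shape : ∀ c i p → c * (i * p) ≡ i * (c * p)
      shape = solve-∀

    ∑-weighted-≥ : ∀ (xs : List A) (ι p : A → ℕ) {c e r} → (∀ x → x ∈ xs → e ≤ c * p x + r) →
                   e * ∑ xs ι ≤ c * ∑[ x ∈ xs ] (ι x * p x) + r * ∑ xs ι
    ∑-weighted-≥ xs ι p {c} {e} {r} h = begin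
      e * ∑ xs ι                                             ≡⟨ ∑-*ˡ xs e ι ⟨
      ∑[ x ∈ xs ] (e * ι x)
          ≤⟨ ∑-mono-∈ xs (λ x x∈ → ≤-trans (*-monoˡ-≤ (ι x) (h x x∈)) (≤-reflexive (shape c (p x) r (ι x))))
          ⟩
      ∑[ x ∈ xs ] (c * (ι x * p x) + r * ι x)
          ≡⟨ trans (∑-+ xs _ _) (cong₂ _+_ (∑-*ˡ xs c _) (∑-*ˡ xs r ι)) ⟩
      c * ∑[ x ∈ xs ] (ι x * p x) + r * ∑ xs ι               ∎
      where
      open ≤-Reasoning
      shape : ∀ c p r i → (c * p + r) * i ≡ c * (i * p) + r * i
      shape = solve-∀

  -- The form of `L` makes `L − 2 = 3 * L′` and `L + 1 = 3 * suc L′`, so the quotient of upper and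
  -- lower walk bounds is exactly `suc L′ / L′`. Here `a` and `a′` count the matchings with and
  -- without the edge, and `r` is a multiple of the common switching count.
  compare-counts : ∀ L′ {d e a a′ r} .{{_ : NonZero e}} → let L = 3 * L′ + 2 in
                   L * (d * e) * a ≤ r + 2 * (d * e) * a → r ≤ suc L * (d * e) * a →
                   L * e * a′ ≤ r + 2 * e * a′ → r ≤ suc L * e * a′ →
                   L′ * (d * a) ≤ suc L′ * a′ × L′ * a′ ≤ suc L′ * (d * a)
  compare-counts L′ {d} {e} {a} {a′} {r} in-lower in-upper out-lower out-upper =
      *-cancelˡ-≤ 3 (*-cancelˡ-≤ e (+-cancelʳ-≤ (2 * (d * e) * a) _ _ (begin
        e * (3 * (L′ * (d * a))) + 2 * (d * e) * a     ≡⟨ shape₁ L′ d e a ⟩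
        (3 * L′ + 2) * (d * e) * a                     ≤⟨ in-lower ⟩
        r + 2 * (d * e) * a                            ≤⟨ +-monoˡ-≤ (2 * (d * e) * a) out-upper ⟩
        suc (3 * L′ + 2) * e * a′ + 2 * (d * e) * a    ≡⟨ cong (_+ 2 * (d * e) * a) (shape₂ L′ e a′) ⟩
        e * (3 * (suc L′ * a′)) + 2 * (d * e) * a      ∎)))
    , *-cancelˡ-≤ 3 (*-cancelˡ-≤ e (+-cancelʳ-≤ (2 * e * a′) _ _ (begin
        e * (3 * (L′ * a′)) + 2 * e * a′               ≡⟨ shape₃ L′ e a′ ⟩
        (3 * L′ + 2) * e * a′                          ≤⟨ out-lower ⟩
        r + 2 * e * a′                                 ≤⟨ +-monoˡ-≤ (2 * e * a′) in-upper ⟩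
        suc (3 * L′ + 2) * (d * e) * a + 2 * e * a′    ≡⟨ cong (_+ 2 * e * a′) (shape₄ L′ d e a) ⟩
        e * (3 * (suc L′ * (d * a))) + 2 * e * a′      ∎)))
    where
    open ≤-Reasoning
    shape₁ : ∀ L d e a → e * (3 * (L * (d * a))) + 2 * (d * e) * a ≡ (3 * L + 2) * (d * e) * a
    shape₁ = solve-∀
    shape₂ : ∀ L e a → suc (3 * L + 2) * e * a ≡ e * (3 * (suc L * a))
    shape₂ = solve-∀
    shape₃ : ∀ L e a → e * (3 * (L * a)) + 2 * e * a ≡ (3 * L + 2) * e * a
    shape₃ = solve-∀
    shape₄ : ∀ L d e a → suc (3 * L + 2) * (d * e) * a ≡ e * (3 * (suc L * (d * a)))
    shape₄ = solve-∀

  -- Passing from `a′` to the total adds `a`, which is at most `d * a / (4 * K)`. In the lower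
  -- estimate this and the comparison error make `2 * (d * a) / (4 * K)`, and `d * a ≤ 2 * t` turns
  -- it into `t / K`.
  conclude-counts : ∀ K {d a a′} .{{_ : NonZero K}} → 4 * K ≤ d →
                    4 * K * (d * a) ≤ suc (4 * K) * a′ → 4 * K * a′ ≤ suc (4 * K) * (d * a) →
                    K * (d * a) ≤ suc K * (a + a′) × K * (a + a′) ≤ K * (d * a) + (a + a′)
  conclude-counts K {d} {a} {a′} 4K≤d lower upper =
      *-cancelˡ-≤ 4 (begin
        4 * (K * (d * a))          ≡⟨ *-assoc 4 K _ ⟨
        4 * K * (d * a)            ≤⟨ da≤ ⟩
        suc (4 * K) * t            ≤⟨ *-monoˡ-≤ t (≤-trans (m≤n+m (suc (4 * K)) 3) (≤-reflexive (shape₁ K)))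
            ⟩
        4 * suc K * t              ≡⟨ *-assoc 4 (suc K) t ⟩
        4 * (suc K * t)            ∎)
    , *-cancelˡ-≤ 4 (begin
        4 * (K * (a + a′))                        ≡⟨ shape₂ K a a′ ⟩
        4 * K * a + 4 * K * a′                    ≤⟨ +-mono-≤ (*-monoˡ-≤ a 4K≤d) upper ⟩
        d * a + suc (4 * K) * (d * a)             ≡⟨ shape₃ K (d * a) ⟩
        4 * (K * (d * a)) + 2 * (d * a)           ≤⟨ +-monoʳ-≤ (4 * (K * (d * a))) (*-monoʳ-≤ 2 da≤2t) ⟩
        4 * (K * (d * a)) + 2 * (2 * t)           ≡⟨ shape₄ (K * (d * a)) t ⟩
        4 * (K * (d * a) + t)                     ∎)
    where
    open ≤-Reasoning
    t : ℕ
    t = a + a′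
    da≤ : 4 * K * (d * a) ≤ suc (4 * K) * t
    da≤ = ≤-trans lower (*-monoʳ-≤ (suc (4 * K)) (m≤n+m a′ a))
    instance
      4K≢0 : NonZero (4 * K)
      4K≢0 = m*n≢0 4 K
    da≤2t : d * a ≤ 2 * t
    da≤2t = *-cancelˡ-≤ (4 * K) (begin
      4 * K * (d * a)          ≤⟨ da≤ ⟩
      suc (4 * K) * t          ≤⟨ *-monoˡ-≤ t (+-monoˡ-≤ (4 * K) (>-nonZero⁻¹ (4 * K))) ⟩
      (4 * K + 4 * K) * t      ≡⟨ shape₅ (4 * K) t ⟩
      4 * K * (2 * t)          ∎)
      where
      shape₅ : ∀ k t → (k + k) * t ≡ k * (2 * t)
      shape₅ = solve-∀
    shape₁ : ∀ K → 3 + suc (4 * K) ≡ 4 * suc K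
    shape₁ = solve-∀
    shape₂ : ∀ K a b → 4 * (K * (a + b)) ≡ 4 * K * a + 4 * K * b
    shape₂ = solve-∀
    shape₃ : ∀ K x → x + suc (4 * K) * x ≡ 4 * (K * x) + 2 * x
    shape₃ = solve-∀
    shape₄ : ∀ x t → 4 * x + 2 * (2 * t) ≡ 4 * (x + t)
    shape₄ = solve-∀

  -- With L = precision K the errors 1 / L and 2 / L of the walk counts combine to
  -- a relative error 1 / (4 K).
  precision : ℕ → ℕ
  precision K = 3 * (4 * K) + 2

  -- The first summand meets the size condition of `P-lower` for walks of at most `suc b` pairs
  -- avoiding at most four vertices, namely `u`, `v` and their partners. The second forces
  -- `4 * K ≤ d`.
  threshold : ℕ → ℕ → ℕ → ℕ
  threshold D N K = D * (D * (L * (suc b * (4 + 2 * suc b)))) + D * (4 * K)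
    where
    L b : ℕ
    L = precision K
    b = burnIn D N L

  module Count {n : ℕ} (D N K : ℕ) .{{_ : NonZero D}} .{{_ : NonZero K}} (2D≤N : 2 * D ≤ N)
      (large : threshold D N K ≤ n)
               (G : Graph n) {d : ℕ} (n≤Dd : n ≤ D * d) (regular : Graphs.IntRegular n d G)
               (robust : Graphs.IntRobust n N (2 * D) G) {u v : Fin n} (Auv : Graph.adjacent G u v ≡ true)
                   where
    open Graphs n
    open Matchings G
    open Switching G

    private
      L b : ℕ
      L = precision K
      b = burnIn D N L

      d≤n : d ≤ n
      d≤n = begin
        d                      ≡⟨ regular u ⟨
        ∑ V (adj G u)          ≤⟨ ∑-mono V (λ w → 𝟙≤1 (Graph.adjacent G u w)) ⟩
        ∑[ w ∈ V ] 1           ≡⟨ trans (∑-V-const 1) (*-identityʳ n) ⟩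
        n                      ∎
        where open ≤-Reasoning

      4K≤d : 4 * K ≤ d
      4K≤d = *-cancelˡ-≤ D (≤-trans (≤-trans (m≤n+m _ _) large) n≤Dd)

      instance
        d≢0 : NonZero d
        d≢0 = >-nonZero (≤-trans (>-nonZero⁻¹ (4 * K) {{m*n≢0 4 K}}) 4K≤d)

      long : ∀ {j f} → j ≤ suc b → f ≤ 4 → D * (D * (L * (j * (f + 2 * j)))) ≤ n
      long j≤ f≤ = ≤-trans (*-monoʳ-≤ D
          (*-monoʳ-≤ D (*-monoʳ-≤ L (*-mono-≤ j≤ (+-mono-≤ f≤ (*-monoʳ-≤ 2 j≤))))))
                           (≤-trans (m≤m+n _ _) large)

      Involutive : Vec (Fin n) n → Set
      Involutive σ = ∀ x → lookup σ (lookup σ x) ≡ x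

      upper : ∀ {σ} → Involutive σ → ∀ {j} F → b ≤ j → ∀ x y → L * n * Pᵛ σ j F x y ≤ suc L * d ^ suc j
      upper {σ} σσ {j} F b≤j x y = ≤-trans (≤-reflexive (*-assoc L n _))
        (Estimates.P-upper D N L 2D≤N G regular n≤Dd d≤n robust (lookup σ) σσ b≤j F x y)

      lower : ∀ {σ} → Involutive σ → ∀ {j} F → b ≤ j → j ≤ suc b → length F ≤ 4 →
              ∀ x y → L * d ^ suc j ≤ L * n * Pᵛ σ j F x y + 2 * d ^ suc j
      lower {σ} σσ {j} F b≤j j≤ f≤ x y = ≤-trans
          (Estimates.P-lower D N L 2D≤N G regular n≤Dd d≤n robust (lookup σ) σσ b≤j F (long j≤ f≤) x y)
        (≤-reflexive (cong (_+ 2 * d ^ suc j) (sym (*-assoc L n _))))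

      2<L : 2 < L
      2<L = +-monoˡ-≤ 2 (>-nonZero⁻¹ (3 * (4 * K)) {{m*n≢0 3 (4 * K) {{_}} {{m*n≢0 4 K}}}})

      -- A vanishing count would contradict the lower estimate, whose relative error `2 / L` is
      -- below 1. All involutions are needed, since the matchings to be augmented still leave
      -- vertices uncovered.
      connected : ∀ σ → Involutive σ → ∀ x y → ∃[ j ] 0 < Pᵛ σ j (x ∷ []) x y
      connected σ σσ x y with Pᵛ σ b (x ∷ []) x y in eq
      ... | suc p = b , subst (0 <_) (sym eq) z<s
      ... | zero  = ⊥-elim (<⇒≱ (*-monoˡ-< (d ^ suc b) {{m^n≢0 d (suc b)}} 2<L)
        (≤-trans (lower {σ} σσ (x ∷ []) ≤-refl (n≤1+n b) (s≤s z≤n) x y)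
                 (≤-reflexive (cong (_+ 2 * d ^ suc b) (trans (cong (L * n *_) eq) (*-zeroʳ (L * n)))))))

      involutive : ∀ {σ} → σ ∈ 𝓜 [] → Involutive σ
      involutive {σ} σ∈ x = proj₁ (∈-𝓜⁻ {[]} {σ} σ∈ x)

      matched unmatched : Vec (Fin n) n → ℕ
      matched σ = [ lookup σ u ≟ꟳ v ]
      unmatched σ = [ ¬? (lookup σ u ≟ꟳ v) ]

      r : ℕ
      r = L * n * R (suc b * 2) (through Auv b) v u

    total : H [] ≡ ∑ (𝓜 []) matched + ∑ (𝓜 []) unmatched
    total = begin
      H []                                              ≡⟨ trans (∑-const (𝓜 []) 1) (*-identityʳ _) ⟨
      ∑[ σ ∈ 𝓜 [] ] 1
          ≡⟨ ∑-cong (𝓜 []) (λ σ → []-+-¬ (does (lookup σ u ≟ꟳ v))) ⟨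
      ∑[ σ ∈ 𝓜 [] ] (matched σ + unmatched σ)           ≡⟨ ∑-+ (𝓜 []) matched unmatched ⟩
      ∑ (𝓜 []) matched + ∑ (𝓜 []) unmatched             ∎
      where open ≡-Reasoning

    exists : 2 ∣ n → 0 < H []
    exists = perfect-matching-exists connected

    counts : K * (d * ∑ (𝓜 []) matched) ≤ suc K * H [] × K * H [] ≤ K * (d * ∑ (𝓜 []) matched) + H []
    counts = subst (λ t → K * (d * ∑ (𝓜 []) matched) ≤ suc K * t × K * t ≤ K * (d * ∑ (𝓜 []) matched) + t)
        (sym total)
      (conclude-counts K 4K≤d (proj₁ compared) (proj₂ compared))
      where
      in-P out-P : Vec (Fin n) n → ℕ
      in-P σ = Pᵛ σ (suc b) (through Auv b) v u
      out-P σ = Pᵛ σ b (avoiding Auv b σ) (lookup σ v) (lookup σ u)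
      -- With `suc b` pairs for matchings containing the edge and `b` for the others, the expected
      -- counts are `d ^ (2 + b) / n` and `d ^ suc b / n`. Their quotient is the factor `d` of the
      -- theorem.
      compared = compare-counts (4 * K) {d} {d ^ suc b} {∑ (𝓜 []) matched} {∑ (𝓜 []) unmatched} {r}
          {{m^n≢0 d (suc b)}}
        (≤-trans (∑-weighted-≥ (𝓜 []) matched in-P {L * n}
            (λ σ σ∈ → lower {σ} (involutive {σ} σ∈) (through Auv b) (n≤1+n b) ≤-refl (s≤s (s≤s z≤n)) v u))
                 (≤-reflexive (cong (λ t → L * n * t + 2 * d ^ (2 + b) * ∑ (𝓜 []) matched)
                     (∑-switch-in Auv b))))
        (≤-trans (≤-reflexive (cong (L * n *_) (sym (∑-switch-in Auv b))))
                 (∑-weighted-≤ (𝓜 []) matched in-P {L * n}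
                     (λ σ σ∈ → upper {σ} (involutive {σ} σ∈) (through Auv b) (n≤1+n b) v u)))
        (≤-trans (∑-weighted-≥ (𝓜 []) unmatched out-P {L * n}
            (λ σ σ∈ → lower {σ} (involutive {σ} σ∈) (avoiding Auv b σ) ≤-refl (n≤1+n b) ≤-refl (lookup σ v)
            (lookup σ u)))
                 (≤-reflexive (cong (λ t → L * n * t + 2 * d ^ suc b * ∑ (𝓜 []) unmatched)
                     (∑-switch-out Auv b))))
        (≤-trans (≤-reflexive (cong (L * n *_) (sym (∑-switch-out Auv b))))
                 (∑-weighted-≤ (𝓜 []) unmatched out-P {L * n}
                     (λ σ σ∈ → upper {σ} (involutive {σ} σ∈) (avoiding Auv b σ) ≤-refl (lookup σ v)
                     (lookup σ u))))

  -- Cardinalities of subsets as sums of indicators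

  ∑-allFin-suc : ∀ {n} (f : Fin (suc n) → ℕ) → ∑ (allFin (suc n)) f ≡ f zero + ∑ (allFin n) (f ∘ suc)
  ∑-allFin-suc {n} f = cong (f zero +_)
      (trans (cong (λ xs → ∑ xs f) (sym (map-tabulate id suc))) (∑-map suc (allFin n) f))

  ∣tabulate∣ : ∀ {n} (s : Fin n → Bool) → ∣ tabulate s ∣ ≡ ∑[ x ∈ allFin n ] 𝟙 (s x)
  ∣tabulate∣ {zero}  s = refl
  ∣tabulate∣ {suc n} s = trans head (sym (∑-allFin-suc (𝟙 ∘ s)))
    where
    head : ∣ tabulate s ∣ ≡ 𝟙 (s zero) + ∑[ x ∈ allFin n ] 𝟙 (s (suc x))
    head with s zero
    ... | true  = cong suc (∣tabulate∣ (s ∘ suc))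
    ... | false = ∣tabulate∣ (s ∘ suc)

  ∣tabulate∩tabulate∣ : ∀ {n} (s t : Fin n → Bool) → ∣ tabulate s ∩ tabulate t ∣ ≡ ∑[ x ∈ allFin n ]
      (𝟙 (s x) * 𝟙 (t x))
  ∣tabulate∩tabulate∣ {zero}  s t = refl
  ∣tabulate∩tabulate∣ {suc n} s t = trans head (sym (∑-allFin-suc (λ x → 𝟙 (s x) * 𝟙 (t x))))
    where
    head : ∣ tabulate s ∩ tabulate t ∣ ≡ 𝟙 (s zero) * 𝟙 (t zero) + ∑[ x ∈ allFin n ]
        (𝟙 (s (suc x)) * 𝟙 (t (suc x)))
    head with s zero | t zero
    ... | true  | true  = cong suc (∣tabulate∩tabulate∣ (s ∘ suc) (t ∘ suc))
    ... | true  | false = ∣tabulate∩tabulate∣ (s ∘ suc) (t ∘ suc)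
    ... | false | _     = ∣tabulate∩tabulate∣ (s ∘ suc) (t ∘ suc)

  -- The accuracy attainable for a given number of vertices

  module Level (T : ℕ → ℕ) where

    -- Searching downwards finds the largest admissible value. The final `zero` is a default that is
    -- admissible once `T 0 ≤ n`, which determines the lower bound on `n` in the theorem.
    search : ℕ → ℕ → ℕ
    search n zero = zero
    search n (suc m) with T (suc m) ≤? n
    ... | yes _ = suc m
    ... | no _  = search n m

    level : ℕ → ℕ
    level n = search n n

    search-admissible : ∀ n m → T 0 ≤ n → T (search n m) ≤ n
    search-admissible n zero    h = h
    search-admissible n (suc m) h with T (suc m) ≤? n
    ... | yes p = p
    ... | no _  = search-admissible n m h

    search-maximal : ∀ n m {k} → k ≤ m → T k ≤ n → k ≤ search n m
    search-maximal n zero    k≤m h = k≤m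
    search-maximal n (suc m) {k} k≤m h with T (suc m) ≤? n
    ... | yes _ = k≤m
    ... | no ¬p with m≤n⇒m<n∨m≡n k≤m
    ...   | inj₁ (s≤s k≤m′) = search-maximal n m k≤m′ h
    ...   | inj₂ refl       = ⊥-elim (¬p h)

    level-admissible : ∀ n → T 0 ≤ n → T (level n) ≤ n
    level-admissible n = search-admissible n n

    level-large : ∀ k n → k ⊔ T k ≤ n → k ≤ level n
    level-large k n h = search-maximal n n (≤-trans (m≤m⊔n k (T k)) h) (≤-trans (m≤n⊔m k (T k)) h)

-- Passage to an ordered field

module OrderedField {c ℓ₁ ℓ₂} (K : ArchimedeanOrderedField c ℓ₁ ℓ₂) where
  open ArchimedeanOrderedField K
  open DecTotalOrder decTotalOrder using (poset; total; antisym) renaming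
      (reflexive to ≤-reflexive; trans to ≤-trans; refl to ≤-refl)
  open RingProperties ring using (-‿distribʳ-*; -‿distribˡ-*; -‿involutive; -‿+-comm)
  open SemiringMult semiring using (×-homo-+; ×1-homo-*)
  open CommutativeSemigroupProperties *-commutativeSemigroup using (x∙yz≈y∙xz)
  open PartialOrderReasoning poset

  fromℕ-+ : ∀ m n → fromℕ (m ℕ.+ n) ≈ fromℕ m + fromℕ n
  fromℕ-+ = ×-homo-+ 1#

  fromℕ-* : ∀ m n → fromℕ (m ℕ.* n) ≈ fromℕ m * fromℕ n
  fromℕ-* = ×1-homo-*

  +-monoʳ-≤ : ∀ z {x y} → x ≤ y → z + x ≤ z + y
  +-monoʳ-≤ z {x} {y} x≤y = begin
    z + x ≈⟨ +-comm z x ⟩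
    x + z ≤⟨ +-monoˡ-≤ z x≤y ⟩
    y + z ≈⟨ +-comm y z ⟩
    z + y ∎

  x+y-y : ∀ x y → x + y - y ≈ x
  x+y-y x y = trans (+-assoc x y (- y)) (trans (+-congˡ (-‿inverseʳ y)) (+-identityʳ x))

  x-y+y : ∀ x y → x - y + y ≈ x
  x-y+y x y = trans (+-assoc x (- y) y) (trans (+-congˡ (-‿inverseˡ y)) (+-identityʳ x))

  +-cancelʳ-≤ : ∀ z {x y} → x + z ≤ y + z → x ≤ y
  +-cancelʳ-≤ z {x} {y} h = begin
    x          ≈⟨ x+y-y x z ⟨
    x + z - z  ≤⟨ +-monoˡ-≤ (- z) h ⟩
    y + z - z  ≈⟨ x+y-y y z ⟩
    y          ∎

  ≤-moveʳ : ∀ {x y z} → x ≤ y + z → x - z ≤ y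
  ≤-moveʳ {x} {y} {z} h = +-cancelʳ-≤ z (≤-trans (≤-reflexive (x-y+y x z)) h)

  ≤-moveˡ : ∀ {x y z} → x + z ≤ y → x ≤ y - z
  ≤-moveˡ {x} {y} {z} h = +-cancelʳ-≤ z (≤-trans h (≤-reflexive (sym (x-y+y y z))))

  0≤-‿ : ∀ {x} → x ≤ 0# → 0# ≤ - x
  0≤-‿ {x} x≤0 = begin
    0#        ≈⟨ -‿inverseʳ x ⟨
    x - x     ≤⟨ +-monoˡ-≤ (- x) x≤0 ⟩
    0# - x    ≈⟨ +-identityˡ (- x) ⟩
    - x       ∎

  *-monoˡ-≤ : ∀ {z} → 0# ≤ z → ∀ {x y} → x ≤ y → z * x ≤ z * y
  *-monoˡ-≤ {z} 0≤z {x} {y} x≤y = begin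
    z * x                      ≈⟨ +-identityˡ (z * x) ⟨
    0# + z * x                 ≤⟨ +-monoˡ-≤ (z * x)
        (*-nonNeg 0≤z (≤-moveˡ (≤-trans (≤-reflexive (+-identityˡ x)) x≤y))) ⟩
    z * (y - x) + z * x        ≈⟨ distribˡ z (y - x) x ⟨
    z * (y - x + x)            ≈⟨ *-congˡ (x-y+y y x) ⟩
    z * y                      ∎

  1≰0 : ¬ (1# ≤ 0#)
  1≰0 1≤0 = 1≉0 (antisym 1≤0 (begin
    0#               ≤⟨ *-nonNeg (0≤-‿ 1≤0) (0≤-‿ 1≤0) ⟩
    - 1# * - 1#      ≈⟨ -‿distribʳ-* (- 1#) 1# ⟨
    - (- 1# * 1#)    ≈⟨ -‿cong (*-identityʳ (- 1#)) ⟩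
    - - 1#           ≈⟨ -‿involutive 1# ⟩
    1#               ∎))

  0≤1 : 0# ≤ 1#
  0≤1 with total 0# 1#
  ... | inj₁ h = h
  ... | inj₂ h = ⊥-elim (1≰0 h)

  0≤fromℕ : ∀ k → 0# ≤ fromℕ k
  0≤fromℕ zero    = ≤-refl
  0≤fromℕ (suc k) = begin
    0#               ≤⟨ 0≤fromℕ k ⟩
    fromℕ k          ≈⟨ +-identityˡ (fromℕ k) ⟨
    0# + fromℕ k     ≤⟨ +-monoˡ-≤ (fromℕ k) 0≤1 ⟩
    1# + fromℕ k     ∎

  fromℕ-mono : ∀ {m n} → m ℕ.≤ n → fromℕ m ≤ fromℕ n
  fromℕ-mono {n = n} ℕ.z≤n   = 0≤fromℕ n
  fromℕ-mono         (ℕ.s≤s h) = +-monoʳ-≤ 1# (fromℕ-mono h)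

  fromℕ-cancel : ∀ {m n} → fromℕ m ≤ fromℕ n → m ℕ.≤ n
  fromℕ-cancel {m} {n} h = ℕₚ.≮⇒≥ λ n<m → 1≰0 (+-cancelʳ-≤ (fromℕ n) (begin
    1# + fromℕ n     ≤⟨ fromℕ-mono n<m ⟩
    fromℕ m          ≤⟨ h ⟩
    fromℕ n          ≈⟨ +-identityˡ (fromℕ n) ⟨
    0# + fromℕ n     ∎))

  fromℕ-suc≉0 : ∀ k → fromℕ (suc k) ≉ 0#
  fromℕ-suc≉0 k eq with fromℕ-cancel {suc k} {0} (≤-reflexive eq)
  ... | ()

  module _ {x : Carrier} (0≤x : 0# ≤ x) (x≉0 : x ≉ 0#) where

    0≤⁻¹ : 0# ≤ x ⁻¹
    0≤⁻¹ with total 0# (x ⁻¹)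
    ... | inj₁ h = h
    ... | inj₂ h = ⊥-elim (1≰0 (begin
      1#                       ≈⟨ *-inverseʳ x x≉0 ⟨
      x * x ⁻¹                 ≤⟨ *-monoˡ-≤ 0≤x h ⟩
      x * 0#                   ≈⟨ zeroʳ x ⟩
      0#                       ∎))

    *-divideˡ : ∀ {y z} → x * y ≤ z → y ≤ x ⁻¹ * z
    *-divideˡ {y} {z} h = begin
      y                  ≈⟨ *-identityˡ y ⟨
      1# * y             ≈⟨ *-congʳ (trans (*-comm (x ⁻¹) x) (*-inverseʳ x x≉0)) ⟨
      x ⁻¹ * x * y       ≈⟨ *-assoc (x ⁻¹) x y ⟩
      x ⁻¹ * (x * y)     ≤⟨ *-monoˡ-≤ 0≤⁻¹ h ⟩
      x ⁻¹ * z           ∎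

    *-divideʳ : ∀ {y z} → z ≤ x * y → x ⁻¹ * z ≤ y
    *-divideʳ {y} {z} h = begin
      x ⁻¹ * z           ≤⟨ *-monoˡ-≤ 0≤⁻¹ h ⟩
      x ⁻¹ * (x * y)     ≈⟨ *-assoc (x ⁻¹) x y ⟨
      x ⁻¹ * x * y       ≈⟨ *-congʳ (trans (*-comm (x ⁻¹) x) (*-inverseʳ x x≉0)) ⟩
      1# * y             ≈⟨ *-identityˡ y ⟩
      y                  ∎

    ⁻¹≉0 : 0# ≉ x ⁻¹
    ⁻¹≉0 eq = 1≉0 (trans (sym (*-inverseʳ x x≉0)) (trans (*-congˡ (sym eq)) (zeroʳ x)))

  reciprocal-bound : ∀ {x} → 0# < x → ∃[ k ] 1# ≤ x * fromℕ k
  reciprocal-bound {x} (0≤x , 0≉x) with archimedean (x ⁻¹)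
  ... | k , h = k , (begin
    1#              ≈⟨ *-inverseʳ x (λ eq → 0≉x (sym eq)) ⟨
    x * x ⁻¹        ≤⟨ *-monoˡ-≤ 0≤x h ⟩
    x * fromℕ k     ∎)

  reciprocal-bound-mono : ∀ {x j k} → 0# ≤ x → 1# ≤ x * fromℕ j → j ℕ.≤ k → 1# ≤ x * fromℕ k
  reciprocal-bound-mono 0≤x h j≤k = ≤-trans h (*-monoˡ-≤ 0≤x (fromℕ-mono j≤k))

  abs-≤ : ∀ {x e} → x ≤ e → - x ≤ e → abs x ≤ e
  abs-≤ = MaxOp.⊔-lub (Max.maxOperator totalOrder)

  unit-fraction : ℕ → Carrier
  unit-fraction k = fromℕ (suc k) ⁻¹

  0≤unit-fraction : ∀ k → 0# ≤ unit-fraction k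
  0≤unit-fraction k = 0≤⁻¹ (0≤fromℕ (suc k)) (fromℕ-suc≉0 k)

  0<unit-fraction : ∀ k → 0# < unit-fraction k
  0<unit-fraction k = 0≤unit-fraction k , ⁻¹≉0 (0≤fromℕ (suc k)) (fromℕ-suc≉0 k)

  -- From `1 ≤ ε k` follows `1 + ε ≤ ε (k + 1)`; the extra `ε` makes the inequality strict.
  unit-fraction-small : ∀ {ε j k} → 0# < ε → 1# ≤ ε * fromℕ j → j ℕ.≤ k → abs (unit-fraction k) < ε
  unit-fraction-small {ε} {j} {k} (0≤ε , 0≉ε) h j≤k = ≤-trans abs≤ q≤ε , λ eq → ε≰q
      (≤-trans (≤-reflexive (sym eq)) abs≤)
    where
    q : Carrier
    q = unit-fraction k
    ε≰q : ¬ (ε ≤ q)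
    ε≰q ε≤q = 0≉ε (antisym 0≤ε (+-cancelʳ-≤ 1# (begin
      ε + 1#                       ≤⟨ +-monoʳ-≤ ε (reciprocal-bound-mono 0≤ε h j≤k) ⟩
      ε + ε * fromℕ k              ≈⟨ +-congʳ (*-identityʳ ε) ⟨
      ε * 1# + ε * fromℕ k         ≈⟨ distribˡ ε 1# (fromℕ k) ⟨
      ε * fromℕ (suc k)            ≈⟨ *-comm ε _ ⟩
      fromℕ (suc k) * ε            ≤⟨ *-monoˡ-≤ (0≤fromℕ (suc k)) ε≤q ⟩
      fromℕ (suc k) * q            ≈⟨ *-inverseʳ _ (fromℕ-suc≉0 k) ⟩
      1#                           ≈⟨ +-identityˡ 1# ⟨
      0# + 1#                      ∎)))
    q≤ε : q ≤ ε
    q≤ε with total q ε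
    ... | inj₁ q≤ε = q≤ε
    ... | inj₂ ε≤q = ⊥-elim (ε≰q ε≤q)
    abs≤ : abs q ≤ q
    abs≤ = abs-≤ ≤-refl (begin
      - q        ≈⟨ +-identityˡ (- q) ⟨
      0# - q     ≤⟨ ≤-moveʳ (≤-trans (0≤unit-fraction k) (≤-reflexive (sym (+-identityˡ q)))) ⟩
      0#         ≤⟨ 0≤unit-fraction k ⟩
      q          ∎)

  -- The integer inequalities say k |d a − t| ≤ t for k = suc k′.
  ratio-bound : ∀ k′ {d a t} → 0 ℕ.< t → let k = suc k′ in
                k ℕ.* (d ℕ.* a) ℕ.≤ suc k ℕ.* t → k ℕ.* t ℕ.≤ k ℕ.* (d ℕ.* a) ℕ.+ t →
                abs (fromℕ d * (fromℕ a * fromℕ t ⁻¹) - 1#) ≤ unit-fraction k′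
  ratio-bound k′ {d} {a} {t@(suc t′)} _ upper lower = abs-≤ (≤-moveʳ X≤) (begin
    - (X - 1#)         ≈⟨ -‿+-comm X (- 1#) ⟨
    - X + - - 1#       ≈⟨ +-congˡ (-‿involutive 1#) ⟩
    - X + 1#           ≈⟨ +-comm (- X) 1# ⟩
    1# - X             ≤⟨ ≤-moveʳ 1≤ ⟩
    κ                  ∎)
    where
    k : ℕ
    k = suc k′
    f : ℕ → Carrier
    f = fromℕ
    κ ti X : Carrier
    κ = unit-fraction k′
    ti = f t ⁻¹
    X = f d * (f a * ti)
    0≤t : 0# ≤ f t
    0≤t = 0≤fromℕ t
    t≉0 : f t ≉ 0#
    t≉0 = fromℕ-suc≉0 t′
    0≤k : 0# ≤ f k
    0≤k = 0≤fromℕ k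
    k≉0 : f k ≉ 0#
    k≉0 = fromℕ-suc≉0 k′
    tX : f t * X ≈ f (d ℕ.* a)
    tX = trans (x∙yz≈y∙xz (f t) (f d) (f a * ti)) (trans (*-congˡ (trans (x∙yz≈y∙xz (f t) (f a) ti)
           (trans (*-congˡ (*-inverseʳ (f t) t≉0)) (*-identityʳ (f a))))) (sym (fromℕ-* d a)))
    tkX : f t * (f k * X) ≈ f (k ℕ.* (d ℕ.* a))
    tkX = trans (x∙yz≈y∙xz (f t) (f k) X) (trans (*-congˡ tX) (sym (fromℕ-* k (d ℕ.* a))))
    cancel-t : ∀ {x y} → f t * x ≤ f t * y → x ≤ y
    cancel-t h = ≤-trans (*-divideˡ 0≤t t≉0 h) (*-divideʳ 0≤t t≉0 ≤-refl)
    cancel-k : ∀ {x y} → f k * x ≤ f k * y → x ≤ y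
    cancel-k h = ≤-trans (*-divideˡ 0≤k k≉0 h) (*-divideʳ 0≤k k≉0 ≤-refl)
    X≤ : X ≤ κ + 1#
    X≤ = cancel-k (cancel-t (begin
      f t * (f k * X)                  ≈⟨ tkX ⟩
      f (k ℕ.* (d ℕ.* a))              ≤⟨ fromℕ-mono upper ⟩
      f (suc k ℕ.* t)                  ≈⟨ fromℕ-* (suc k) t ⟩
      f (suc k) * f t                  ≈⟨ *-comm (f (suc k)) (f t) ⟩
      f t * (1# + f k)                 ≈⟨ *-congˡ (+-cong (*-inverseʳ (f k) k≉0) (*-identityʳ (f k))) ⟨
      f t * (f k * κ + f k * 1#)       ≈⟨ *-congˡ (distribˡ (f k) κ 1#) ⟨
      f t * (f k * (κ + 1#))           ∎))
    1≤ : 1# ≤ κ + X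
    1≤ = cancel-k (cancel-t (begin
      f t * (f k * 1#)                     ≈⟨ *-congˡ (*-identityʳ (f k)) ⟩
      f t * f k                            ≈⟨ trans (fromℕ-* k t) (*-comm (f k) (f t)) ⟨
      f (k ℕ.* t)                          ≤⟨ fromℕ-mono lower ⟩
      f (k ℕ.* (d ℕ.* a) ℕ.+ t)            ≈⟨ fromℕ-+ (k ℕ.* (d ℕ.* a)) t ⟩
      f (k ℕ.* (d ℕ.* a)) + f t            ≈⟨ +-cong (sym tkX) (sym (*-identityʳ (f t))) ⟩
      f t * (f k * X) + f t * 1#           ≈⟨ distribˡ (f t) (f k * X) 1# ⟨
      f t * (f k * X + 1#)                 ≈⟨ *-congˡ (+-comm (f k * X) 1#) ⟩
      f t * (1# + f k * X)                 ≈⟨ *-congˡ (+-congʳ (*-inverseʳ (f k) k≉0)) ⟨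
      f t * (f k * κ + f k * X)            ≈⟨ *-congˡ (distribˡ (f k) κ X) ⟨
      f t * (f k * (κ + X))                ∎))

-- Integer form of density, regularity and robust expansion

open Counting

module ClearDenominators {c ℓ₁ ℓ₂} (K : ArchimedeanOrderedField c ℓ₁ ℓ₂) where
  open ArchimedeanOrderedField K
  open OrderedField K
  open DecTotalOrder decTotalOrder using (poset) renaming
      (reflexive to ≤-reflexive; trans to ≤-trans; refl to ≤-refl)
  open PartialOrderReasoning poset

  -- Via m ≤ D x m ≤ D d. It serves with `x = δ` for the degree and with `x = ν` for robust
  -- neighbourhoods.
  clear : ∀ {x D m d} → 1# ≤ x * fromℕ D → x * fromℕ m ≤ fromℕ d → m ℕ.≤ D ℕ.* d
  clear {x} {D} {m} {d} 1≤xD xm≤d = fromℕ-cancel (begin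
    fromℕ m                        ≈⟨ *-identityʳ (fromℕ m) ⟨
    fromℕ m * 1#                   ≤⟨ *-monoˡ-≤ (0≤fromℕ m) 1≤xD ⟩
    fromℕ m * (x * fromℕ D)        ≈⟨ *-comm _ _ ⟩
    x * fromℕ D * fromℕ m          ≈⟨ *-congʳ (*-comm x (fromℕ D)) ⟩
    fromℕ D * x * fromℕ m          ≈⟨ *-assoc _ _ _ ⟩
    fromℕ D * (x * fromℕ m)        ≤⟨ *-monoˡ-≤ (0≤fromℕ D) xm≤d ⟩
    fromℕ D * fromℕ d              ≈⟨ fromℕ-* D d ⟨
    fromℕ (D ℕ.* d)                ∎)

  module _ {n : ℕ} (G : Graph n) where
    open Graphs n

    regular⇒IntRegular : ∀ {d} → Graph.Regular G d → IntRegular d G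
    regular⇒IntRegular regular x = ≡.trans (≡.sym (∣tabulate∣ (Graph.adjacent G x))) (regular x)

    module _ {ν : Carrier} {N : ℕ} (1≤νN : 1# ≤ ν * fromℕ N) where

      robustNeighbourhood-≤-rn : ∀ s → ∣ robustNeighbourhood K ν G (tabulate s) ∣ ℕ.≤ size (rn N G s)
      robustNeighbourhood-≤-rn s = ℕₚ.≤-trans (ℕₚ.≤-reflexive (∣tabulate∣ p)) (∑-mono V λ z → pointwise z)
        where
        degree : Fin n → ℕ
        degree z = ∣ Graph.neighbours G z ∩ tabulate s ∣
        p : Fin n → Bool
        p z = does (ν * fromℕ n ≤? fromℕ (degree z))
        pointwise : ∀ z → 𝟙 (p z) ℕ.≤ 𝟙 (rn N G s z)
        pointwise z with ν * fromℕ n ≤? fromℕ (degree z)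
        ... | no _  = ℕ.z≤n
        ... | yes h = ℕₚ.≤-reflexive (≡.sym ([]-true (n ℕₚ.≤? N ℕ.* degreeInto G s z)
          (≡.subst (λ m → n ℕ.≤ N ℕ.* m) (∣tabulate∩tabulate∣ (Graph.adjacent G z) s)
              (clear {ν} {N} {n} {degree z} 1≤νN h))))

      -- Rounding ν down to 1 / N enlarges the robust neighbourhoods and lowers the growth demanded
      -- of them, so expansion survives. The range of set sizes is translated without rounding, τ
      -- being a unit fraction.
      robust⇒IntRobust : ∀ t → RobustExpander K ν (unit-fraction t) G → IntRobust N (suc t) G
      robust⇒IntRobust t robust s low high = ℕₚ.≤-trans (fromℕ-cancel (begin
        f (N ℕ.* size s ℕ.+ n)                    ≈⟨ fromℕ-+ (N ℕ.* size s) n ⟩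
        f (N ℕ.* size s) + f n
            ≤⟨ +-monoʳ-≤ (f (N ℕ.* size s))
            (≤-trans (≤-reflexive (sym (*-identityʳ (f n)))) (*-monoˡ-≤ (0≤fromℕ n) 1≤νN)) ⟩
        f (N ℕ.* size s) + f n * (ν * f N)
            ≈⟨ +-cong (fromℕ-* N (size s)) (trans (sym (*-assoc (f n) ν (f N)))
            (trans (*-comm (f n * ν) (f N)) (*-congˡ (*-comm (f n) ν)))) ⟩
        f N * f (size s) + f N * (ν * f n)        ≈⟨ distribˡ (f N) _ _ ⟨
        f N * (f (size s) + ν * f n)              ≤⟨ *-monoˡ-≤ (0≤fromℕ N) expand ⟩
        f N * f ∣ RN ∣                            ≈⟨ fromℕ-* N ∣ RN ∣ ⟨
        f (N ℕ.* ∣ RN ∣)                          ∎)) (ℕₚ.*-monoʳ-≤ N (robustNeighbourhood-≤-rn s))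
        where
        f : ℕ → Carrier
        f = fromℕ
        T : ℕ
        T = suc t
        τ : Carrier
        τ = unit-fraction t
        S = tabulate s
        RN = robustNeighbourhood K ν G S
        expand : f (size s) + ν * f n ≤ f ∣ RN ∣
        expand = ≡.subst (λ k → f k + ν * f n ≤ f ∣ RN ∣) (∣tabulate∣ s) (robust S
          (≡.subst (λ k → τ * f n ≤ f k) (≡.sym (∣tabulate∣ s))
            (*-divideʳ (0≤fromℕ T) (fromℕ-suc≉0 t)
                (≤-trans (fromℕ-mono low) (≤-reflexive (fromℕ-* T (size s))))))
          (≡.subst (λ k → f k ≤ (1# - τ) * f n) (≡.sym (∣tabulate∣ s)) (begin
            f (size s)                        ≤⟨ ≤-moveˡ sparse ⟩
            f n - τ * f n                     ≈⟨ +-cong (sym (*-identityˡ (f n))) (-‿distribˡ-* τ (f n)) ⟩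
            1# * f n + - τ * f n              ≈⟨ distribʳ (f n) 1# (- τ) ⟨
            (1# - τ) * f n                    ∎)))
          where
          open import Algebra.Properties.Ring ring using (-‿distribˡ-*)
          sparse : f (size s) + τ * f n ≤ f n
          sparse = begin
            f (size s) + τ * f n
                ≈⟨ +-congʳ (trans (*-congʳ (trans (*-comm τ (f T)) (*-inverseʳ (f T) (fromℕ-suc≉0 t))))
                (*-identityˡ _)) ⟨
            τ * f T * f (size s) + τ * f n         ≈⟨ +-congʳ (*-assoc τ (f T) (f (size s))) ⟩
            τ * (f T * f (size s)) + τ * f n       ≈⟨ distribˡ τ _ _ ⟨
            τ * (f T * f (size s) + f n)           ≈⟨ *-congˡ (+-congʳ (fromℕ-* T (size s))) ⟨
            τ * (f (T ℕ.* size s) + f n)           ≈⟨ *-congˡ (fromℕ-+ (T ℕ.* size s) n) ⟨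
            τ * f (T ℕ.* size s ℕ.+ n)
                ≤⟨ *-divideʳ (0≤fromℕ T) (fromℕ-suc≉0 t)
                (≤-trans (fromℕ-mono high) (≤-reflexive (fromℕ-* T n))) ⟩
            f n                                    ∎

theorem1p1 : ∀ {c ℓ₁ ℓ₂} (K : ArchimedeanOrderedField c ℓ₁ ℓ₂) →
    let open ArchimedeanOrderedField K in
    ∀ δ → 0# < δ →
    ∃[ τ ] (0# < τ ×
    (∀ ν → 0# < ν →
    Σ[ n₀ ∈ ℕ ] Σ[ η ∈ (ℕ → Carrier) ]
    ((∀ n → 0# ≤ η n) × TendsToZero η ×
    (∀ n → n₀ ℕ.≤ n → 2 ∣ n →
    ∀ d → δ * fromℕ n ≤ fromℕ d →
    (G : Graph n) → Graph.Regular G d → RobustExpander K ν τ G →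
    (e : Edge n) → e ∈ edges G →
    perfectMatchings G ≢ [] ×
    abs (fromℕ d * uniformProbability K (perfectMatchings G) (e ∈?_) - 1#) ≤ η n))))
theorem1p1 {c} {ℓ₁} {ℓ₂} K δ 0<δ = unit-fraction t , 0<unit-fraction t , main
  where
  open ArchimedeanOrderedField K
  open OrderedField K
  open ClearDenominators K

  D₀ D t : ℕ
  D₀ = proj₁ (reciprocal-bound 0<δ)
  D = suc D₀
  -- `suc t` computes to `2 * D`, so that τ is 1 / (2 D).
  t = ℕ.pred (2 ℕ.* D)

  1≤δD : 1# ≤ δ * fromℕ D
  1≤δD = reciprocal-bound-mono (proj₁ 0<δ) (proj₂ (reciprocal-bound 0<δ)) (ℕₚ.n≤1+n D₀)

  module _ (ν : Carrier) (0<ν : 0# < ν) where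

    N : ℕ
    -- The first summand gives 1 ≤ ν N; the second gives `2 * D ≤ N`, needed where the degree
    -- finishes the growth.
    N = proj₁ (reciprocal-bound 0<ν) ℕ.+ 2 ℕ.* D

    1≤νN : 1# ≤ ν * fromℕ N
    1≤νN = reciprocal-bound-mono (proj₁ 0<ν) (proj₂ (reciprocal-bound 0<ν))
        (ℕₚ.m≤m+n (proj₁ (reciprocal-bound 0<ν)) (2 ℕ.* D))

    -- Level `k` stands for accuracy `suc k`, which is never zero and matches `unit-fraction k`.
    open Level (λ k → threshold D N (suc k))

    η : ℕ → Carrier
    η n = unit-fraction (level n)

    η-tendsToZero : TendsToZero η
    η-tendsToZero ε 0<ε with reciprocal-bound 0<ε
    ... | k , h = k ℕ.⊔ threshold D N (suc k) , λ n large → unit-fraction-small 0<ε h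
        (level-large k n large)

    estimate : ∀ n → threshold D N 1 ℕ.≤ n → 2 ∣ n → ∀ d → δ * fromℕ n ≤ fromℕ d →
               (G : Graph n) → Graph.Regular G d → RobustExpander K ν (unit-fraction t) G →
               (e : Edge n) → e ∈ edges G →
               perfectMatchings G ≢ [] ×
               abs (fromℕ d * uniformProbability K (perfectMatchings G) (e ∈?_) - 1#) ≤ η n
    estimate n large even d dense G regular robust e@(u , v) e∈ =
        (λ eq → ℕₚ.<⇒≢ nonempty (≡.sym (≡.cong length eq)))
      , ratio-bound (level n) {d} {length (filter (e ∈?_) (perfectMatchings G))}
          {length (perfectMatchings G)} nonempty
          (≡.subst₂ (λ a h → k ℕ.* (d ℕ.* a) ℕ.≤ suc k ℕ.* h) (≡.sym (length-containing e∈))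
              (≡.sym length-perfectMatchings) (proj₁ counts))
          (≡.subst₂ (λ a h → k ℕ.* h ℕ.≤ k ℕ.* (d ℕ.* a) ℕ.+ h) (≡.sym (length-containing e∈))
              (≡.sym length-perfectMatchings) (proj₂ counts))
      where
      k : ℕ
      k = suc (level n)
      open Encoding G
      open Count {n} D N k (ℕₚ.m≤n+m _ _) (level-admissible n large) G {d}
          (clear {δ} {D} {n} {d} 1≤δD dense)
        (regular⇒IntRegular G regular) (robust⇒IntRobust G {ν} {N} 1≤νN t robust) (proj₂ (∈-edges⁻ e∈))
      nonempty : 0 ℕ.< length (perfectMatchings G)
      nonempty = ≡.subst (0 ℕ.<_) (≡.sym length-perfectMatchings) (exists even)

  main : ∀ ν → 0# < ν → _
  main ν 0<ν = threshold D N₁ 1 , η ν 0<ν ,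
      (λ n → 0≤unit-fraction (Level.level (λ k → threshold D N₁ (suc k)) n)) , η-tendsToZero ν 0<ν ,
      estimate ν 0<ν
    where
    N₁ : ℕ
    N₁ = N ν 0<ν
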